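{- For all $k \in \mathbb{N}$ we have $\mathrm{minvdeg}(\mathcal{MU}_{\delta=k}) \le \mathrm{N}_1(k)$, where $\mathrm{N}_1 = \mathrm{nM}([2,4,5,6,8,8])$ and $[2,4,5,6,8,8]$ denotes the function $f : \mathbb{N} \to \mathbb{N} \cup \{+\infty\}$ with $(f(1),\dots,f(6)) = (2,4,5,6,8,8)$ and $f(k) = +\infty$ for $k \ge 7$.
   Context: Literals come with a fixed-point-free involution $x \mapsto \overline{x}$; variables are positive literals. A clause is a finite set $C$ of literals with $C \cap \overline{C} = \emptyset$; a clause-set is a finite set of clauses; $\delta(F) = |F| - |\mathrm{var}(F)|$. $\mathcal{MU}_{\delta=k}$ is the class of minimally unsatisfiable clause-sets (unsatisfiable, satisfiable after removing any clause) with $\delta = k$. $\mathrm{vdeg}_F(v)$ is the number of clauses of $F$ containing $v$ or $\overline{v}$; $\mathrm{minvdeg}(F) = \min_{v \in \mathrm{var}(F)} \mathrm{vdeg}_F(v)$; for a class $\mathcal{D}$, $\mathrm{minvdeg}(\mathcal{D})$ is the supremum of $\mathrm{minvdeg}(F)$ over $F \in \mathcal{D}$ with $\mathrm{var}(F) \ne \emptyset$. For $g : \mathbb{N} \to \mathbb{N} \cup \{+\infty\}$ and $k \ge 2$, $m \ge 4$, $\mathrm{pdp}_g(k,m)$ is the set of pairs $(e_0,e_1) \in \mathbb{N}^2$ with (i) $e_0, e_1 \ge 2$; (ii) $e_0,e_1 \le k$; (iii) $e_0+e_1 = m$; (iv) $e_0 \le e_1$; (v) $g(k-e_\varepsilon+1)+e_\varepsilon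 \ge m$ for both $\varepsilon \in \{0,1\}$. For $f$ with $f(1) = 2$, $f' = \mathrm{nM}(f)$ is defined by $f'(1) = 2$ and, for $k > 1$, $f'(k) = \min(m, f(k))$ where $m$ is the largest integer in $\{4,\dots,2k\}$ with $\mathrm{pdp}_{f'}(k,m) \ne \emptyset$ (this uses only $f'(k')$ for $k' < k$). -}

module Defs where

open import Data.Bool.Base using (Bool; true; false; not)
import Data.Bool.Properties as Bool
open import Data.Fin.Base using (Fin)
open import Data.Integer.Base using (ℤ; +_; _⊖_)
open import Data.List.Base using (List; []; _∷_; length; map; concatMap; filter; removeAt; upTo; deduplicate)
open import Data.List.Extrema.Nat using (max; min; xs≤max; argmax-sel)
open import Data.List.Membership.Propositional using (_∈_)
open import Data.List.Membership.Propositional.Properties using (∈-filter⁺; ∈-filter⁻; ∈-upTo⁺; ∈-upTo⁻)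
import Data.List.Membership.DecPropositional as DecMembership
open import Data.List.Properties using (filter-≐)
open import Data.List.Relation.Binary.BagAndSetEquality using (_∼[_]_; set)
open import Data.List.Relation.Binary.Disjoint.Propositional using (Disjoint)
open import Data.List.Relation.Unary.All as All using (All)
open import Data.List.Relation.Unary.AllPairs using (AllPairs)
open import Data.List.Relation.Unary.Any using (Any)
open import Data.Nat.Base using (ℕ; zero; suc; _+_; _*_; _∸_; _⊓_; _≤_; _<_; z≤n; s≤s)
open import Data.Nat.Properties
open import Data.Product.Base using (∃; ∃₂; Σ; _×_; _,_; proj₁; proj₂)
open import Data.Product.Properties using () renaming (≡-dec to ×-≡-dec)
open import Data.Sum.Base using (inj₁; inj₂)
open import Function.Base using (_∘_)
open import Function.Bundles using (_⇔_; mk⇔)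
open import Relation.Binary.Construct.Add.Supremum.NonStrict _≤_ using (_≤⁺_; [_]; _≤⊤⁺; ≤⁺-dec; ≤⁺-trans)
open import Relation.Binary.Definitions using (DecidableEquality)
open import Relation.Binary.PropositionalEquality
open import Relation.Nullary using (¬_; Dec; yes; no; contradiction)
open import Relation.Nullary.Construct.Add.Supremum public using (_⁺; ⊤⁺; [_])
open import Relation.Nullary.Decidable using (_×-dec_; _⊎-dec_; map′)

ℕ∞ : Set
ℕ∞ = ℕ ⁺

-- For a set S of natural numbers, "sup S ≤ b" is expressed by "b is an upper
-- bound of S".  A least upper bound in ℕ∞ cannot be computed constructively
-- for an arbitrary S; `sup⊑⇔` checks that this is the right condition
-- whenever s is the supremum.

sup_⊑_ : (ℕ → Set) → ℕ∞ → Set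
sup S ⊑ b = ∀ n → S n → [ n ] ≤⁺ b

IsSup : (ℕ → Set) → ℕ∞ → Set
IsSup S s = (sup S ⊑ s) × (∀ b → sup S ⊑ b → s ≤⁺ b)

sup⊑⇔ : ∀ {S s} → IsSup S s → ∀ b → (s ≤⁺ b) ⇔ (sup S ⊑ b)
sup⊑⇔ (ub , least) b =
  mk⇔ (λ s≤b n Sn → ≤⁺-trans ≤-trans (ub n Sn) s≤b) (least b)

module ClauseSets {V : Set} (_≟ᵛ_ : DecidableEquality V) where

  -- (v , true) is the variable v as a positive literal, (v , false) its
  -- complement.

  Literal : Set
  Literal = V × Bool

  complement : Literal → Literal
  complement (v , b) = v , not b

  _≟ˡ_ : DecidableEquality Literal
  _≟ˡ_ = ×-≡-dec _≟ᵛ_ Bool._≟_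

  open DecMembership _≟ˡ_ using (_∈?_)

  -- Finite sets of literals are lists up to having the same elements (_≈ᶜ_);
  -- clause-sets are lists without repetition up to _≈ᶜ_, so that `length` is
  -- the cardinality.

  record Clause : Set where
    constructor clause
    field
      literals  : List Literal
      clashFree : Disjoint literals (map complement literals)

  open Clause public

  _≈ᶜ_ : Clause → Clause → Set
  C ≈ᶜ D = literals C ∼[ set ] literals D

  record ClauseSet : Set where
    constructor clauseSet
    field
      clauses  : List Clause
      distinct : AllPairs (λ C D → ¬ (C ≈ᶜ D)) clauses

  open ClauseSet public

  var : ClauseSet → List V
  var F = deduplicate _≟ᵛ_ (concatMap (map proj₁ ∘ literals) (clauses F))

  δ : ClauseSet → ℤ
  δ F = length (clauses F) ⊖ length (var F)

  Assignment : Set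
  Assignment = V → Bool

  _makesTrue_ : Assignment → Literal → Set
  φ makesTrue (v , b) = φ v ≡ b

  Satisfiable : List Clause → Set
  Satisfiable Cs = ∃ λ φ → All (Any (φ makesTrue_) ∘ literals) Cs

  MinimallyUnsatisfiable : ClauseSet → Set
  MinimallyUnsatisfiable F =
    ¬ Satisfiable (clauses F) ×
    (∀ (i : Fin (length (clauses F))) → Satisfiable (removeAt (clauses F) i))

  MUδ= : ℕ → ClauseSet → Set
  MUδ= k F = MinimallyUnsatisfiable F × δ F ≡ + k

  vdeg : ClauseSet → V → ℕ
  vdeg F v = length (filter
    (λ C → ((v , true) ∈? literals C) ⊎-dec ((v , false) ∈? literals C))
    (clauses F))

  minimumOf : (V → ℕ) → (vs : List V) → vs ≢ [] → ℕ
  minimumOf d []       ne = contradiction refl ne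
  minimumOf d (v ∷ vs) _  = min (d v) (map d vs)

  minvdeg : (F : ClauseSet) → var F ≢ [] → ℕ
  minvdeg F = minimumOf (vdeg F) (var F)

  -- The set of numbers whose supremum is minvdeg(𝒟).

  minvdegs : (ClauseSet → Set) → ℕ → Set
  minvdegs 𝒟 n = ∃ λ F → 𝒟 F × Σ (var F ≢ []) λ ne → minvdeg F ne ≡ n

infixl 6 _+∞_
_+∞_ : ℕ∞ → ℕ → ℕ∞
[ m ] +∞ n = [ m + n ]
⊤⁺    +∞ n = ⊤⁺

infixl 7 _⊓∞_
_⊓∞_ : ℕ → ℕ∞ → ℕ
m ⊓∞ [ n ] = m ⊓ n
m ⊓∞ ⊤⁺    = m

-- The functions g, f and nM f below have domain {1, 2, …}; their value at 0 is
-- never used.  In particular k ∸ e + 1 ≥ 1, and the truncated subtraction is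
-- exact because of e ≤ k.

record Pdp (g : ℕ → ℕ∞) (k m e₀ e₁ : ℕ) : Set where
  constructor mkPdp
  field
    2≤e₀   : 2 ≤ e₀
    2≤e₁   : 2 ≤ e₁
    e₀≤k   : e₀ ≤ k
    e₁≤k   : e₁ ≤ k
    sum    : e₀ + e₁ ≡ m
    e₀≤e₁  : e₀ ≤ e₁
    bound₀ : [ m ] ≤⁺ g (k ∸ e₀ + 1) +∞ e₀
    bound₁ : [ m ] ≤⁺ g (k ∸ e₁ + 1) +∞ e₁

pdp≢∅ : (ℕ → ℕ∞) → ℕ → ℕ → Set
pdp≢∅ g k m = ∃₂ (Pdp g k m)

pdp? : ∀ g k m e₀ e₁ → Dec (Pdp g k m e₀ e₁)
pdp? g k m e₀ e₁ =
  map′ (λ (a , b , c , d , e , f , h , i) → mkPdp a b c d e f h i)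
       (λ (mkPdp a b c d e f h i) → a , b , c , d , e , f , h , i)
       ((2 ≤? e₀) ×-dec (2 ≤? e₁) ×-dec (e₀ ≤? k) ×-dec (e₁ ≤? k) ×-dec
        (e₀ + e₁ ≟ m) ×-dec (e₀ ≤? e₁) ×-dec
        ≤⁺-dec _≤?_ _ (g (k ∸ e₀ + 1) +∞ e₀) ×-dec
        ≤⁺-dec _≤?_ _ (g (k ∸ e₁ + 1) +∞ e₁))

pdp≢∅? : ∀ g k m → Dec (pdp≢∅ g k m)
pdp≢∅? g k m =
  map′ (λ (e₀ , _ , e₁ , _ , p) → e₀ , e₁ , p)
       (λ (e₀ , e₁ , p) → e₀ , s≤s (Pdp.e₀≤k p) , e₁ , s≤s (Pdp.e₁≤k p) , p)
       (anyUpTo? (λ e₀ → anyUpTo? (pdp? g k m e₀) (suc k)) (suc k))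

-- The m ∈ {4, …, 2k} with pdp_g(k, m) ≠ ∅.

candidate? : ∀ g k m → Dec (4 ≤ m × pdp≢∅ g k m)
candidate? g k m = (4 ≤? m) ×-dec pdp≢∅? g k m

candidates : (ℕ → ℕ∞) → ℕ → List ℕ
candidates g k = filter (candidate? g k) (upTo (suc (2 * k)))

nMstep : (ℕ → ℕ∞) → (ℕ → ℕ) → ℕ → ℕ
nMstep f g 1 = 2
nMstep f g k = max 0 (candidates ([_] ∘ g) k) ⊓∞ f k

-- nMUpTo f n agrees with nM(f) on {1, …, n}.

nMUpTo : (ℕ → ℕ∞) → ℕ → ℕ → ℕ
nMUpTo f zero    k = 0
nMUpTo f (suc n) k with k ≟ suc n
... | yes _ = nMstep f (nMUpTo f n) (suc n)
... | no  _ = nMUpTo f n k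

nM : (ℕ → ℕ∞) → ℕ → ℕ
nM f k = nMUpTo f k k

[2,4,5,6,8,8] : ℕ → ℕ∞
[2,4,5,6,8,8] 1 = [ 2 ]
[2,4,5,6,8,8] 2 = [ 4 ]
[2,4,5,6,8,8] 3 = [ 5 ]
[2,4,5,6,8,8] 4 = [ 6 ]
[2,4,5,6,8,8] 5 = [ 8 ]
[2,4,5,6,8,8] 6 = [ 8 ]
[2,4,5,6,8,8] _ = ⊤⁺

N₁ : ℕ → ℕ
N₁ = nM [2,4,5,6,8,8]

-- nM f satisfies its defining recursion: for k > 1 the largest m exists as soon
-- as f ≥ 2, and nM f k = min(m, f k).

record IsLargest (g : ℕ → ℕ∞) (k m : ℕ) : Set where
  constructor mkLargest
  field
    4≤m     : 4 ≤ m
    m≤2k    : m ≤ 2 * k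
    witness : pdp≢∅ g k m
    maximal : ∀ n → 4 ≤ n → n ≤ 2 * k → pdp≢∅ g k n → n ≤ m

private
  <-index : ∀ {k e} → 2 ≤ e → e ≤ k → k ∸ e + 1 < k
  <-index {k} {e} 2≤e e≤k = begin-strict
    k ∸ e + 1  <⟨ +-monoʳ-< (k ∸ e) 2≤e ⟩
    k ∸ e + e  ≡⟨ m∸n+n≡m e≤k ⟩
    k          ∎
    where open ≤-Reasoning

  Pdp-local : ∀ {g h k m} → (∀ j → j < k → g j ≡ h j) →
              pdp≢∅ g k m → pdp≢∅ h k m
  Pdp-local {m = m} g≡h (e₀ , e₁ , mkPdp a b c d e f p q) =
    e₀ , e₁ , mkPdp a b c d e f
      (subst (λ x → [ m ] ≤⁺ x +∞ e₀) (g≡h _ (<-index a c)) p)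
      (subst (λ x → [ m ] ≤⁺ x +∞ e₁) (g≡h _ (<-index b d)) q)

  candidates-local : ∀ {g h} k → (∀ j → j < k → g j ≡ h j) →
                     candidates g k ≡ candidates h k
  candidates-local {g} {h} k g≡h = filter-≐ (candidate? g k) (candidate? h k)
    ( (λ (p , q) → p , Pdp-local g≡h q)
    , (λ (p , q) → p , Pdp-local (λ j j<k → sym (g≡h j j<k)) q))
    (upTo (suc (2 * k)))

  nMstep-local : ∀ f {g h} k → (∀ j → j < k → g j ≡ h j) →
                 nMstep f g k ≡ nMstep f h k
  nMstep-local f {g} {h} zero g≡h =
    cong (λ xs → max 0 xs ⊓∞ f 0)
      (candidates-local {[_] ∘ g} {[_] ∘ h} 0 λ _ ())
  nMstep-local f 1 g≡h = refl
  nMstep-local f k@(suc (suc _)) g≡h =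
    cong (λ xs → max 0 xs ⊓∞ f k)
      (candidates-local k λ j j<k → cong [_] (g≡h j j<k))

  nMUpTo-new : ∀ f n → nMUpTo f (suc n) (suc n) ≡ nMstep f (nMUpTo f n) (suc n)
  nMUpTo-new f n with suc n ≟ suc n
  ... | yes _ = refl
  ... | no ≢  = contradiction refl ≢

  nMUpTo-old : ∀ f {n k} → k ≤ n → nMUpTo f (suc n) k ≡ nMUpTo f n k
  nMUpTo-old f {n} {k} k≤n with k ≟ suc n
  ... | yes refl = contradiction k≤n (<-irrefl refl)
  ... | no _     = refl

  nMUpTo-stable : ∀ f n {k} → k ≤ n → nMUpTo f n k ≡ nM f k
  nMUpTo-stable f zero z≤n = refl
  nMUpTo-stable f (suc n) {k} k≤1+n with m≤n⇒m<n∨m≡n k≤1+n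
  ... | inj₁ (s≤s k≤n) = trans (nMUpTo-old f k≤n) (nMUpTo-stable f n k≤n)
  ... | inj₂ refl      = refl

  max-∈ : ∀ {m} xs → m ∈ xs → 0 < m → max 0 xs ∈ xs
  max-∈ xs m∈xs 0<m with argmax-sel (λ x → x) 0 xs
  ... | inj₂ ∈xs  = ∈xs
  ... | inj₁ max≡0 = contradiction
    (<-≤-trans 0<m (subst (_ ≤_) max≡0 (All.lookup (xs≤max 0 xs) m∈xs)))
    (<-irrefl refl)

  ⊓∞-glb : ∀ {l m x} → l ≤ m → [ l ] ≤⁺ x → l ≤ m ⊓∞ x
  ⊓∞-glb l≤m [ l≤n ]    = ⊓-glb l≤m l≤n
  ⊓∞-glb l≤m (_ ≤⊤⁺)    = l≤m

nM-unfold : ∀ f {k} → 1 ≤ k → nM f k ≡ nMstep f (nM f) k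
nM-unfold f {suc n} _ = trans (nMUpTo-new f n)
  (nMstep-local f (suc n) λ j j<1+n → nMUpTo-stable f n (≤-pred j<1+n))

largest : ∀ g k → 2 ≤ k → [ 2 ] ≤⁺ g (k ∸ 2 + 1) →
          IsLargest g k (max 0 (candidates g k))
largest g k 2≤k 2≤g = mkLargest
  (proj₁ (proj₂ max-prop))
  (≤-pred (∈-upTo⁻ (proj₁ max-prop)))
  (proj₂ (proj₂ max-prop))
  λ n 4≤n n≤2k p → All.lookup (xs≤max 0 (candidates g k))
    (∈-filter⁺ (candidate? g k) (∈-upTo⁺ (s≤s n≤2k)) (4≤n , p))
  where
  4≤ : ∀ {x} → [ 2 ] ≤⁺ x → [ 4 ] ≤⁺ x +∞ 2
  4≤ [ 2≤n ]   = [ +-monoˡ-≤ 2 2≤n ]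
  4≤ (_ ≤⊤⁺)   = _ ≤⊤⁺

  max-prop = ∈-filter⁻ (candidate? g k) {xs = upTo (suc (2 * k))}
    (max-∈ (candidates g k)
      (∈-filter⁺ (candidate? g k) (∈-upTo⁺ (s≤s (*-monoʳ-≤ 2 2≤k)))
        (≤-refl , 2 , 2 ,
         mkPdp ≤-refl ≤-refl 2≤k 2≤k refl ≤-refl (4≤ 2≤g) (4≤ 2≤g)))
      (s≤s z≤n))

module _ (f : ℕ → ℕ∞) (2≤f : ∀ k → [ 2 ] ≤⁺ f k) where

  private
    2≤nMUpTo : ∀ n k → 1 ≤ k → k ≤ n → 2 ≤ nMUpTo f n k
    2≤nMUpTo zero    k 1≤k k≤0 = contradiction (≤-trans 1≤k k≤0) λ ()
    2≤nMUpTo (suc n) k 1≤k k≤1+n with k ≟ suc n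
    2≤nMUpTo (suc n) k 1≤k k≤1+n | no k≢ =
      2≤nMUpTo n k 1≤k (≤-pred (≤∧≢⇒< k≤1+n k≢))
    2≤nMUpTo 1 _ 1≤k k≤1+n | yes refl = ≤-refl
    2≤nMUpTo (suc (suc n)) k 1≤k k≤1+n | yes refl =
      ⊓∞-glb
        (≤-trans (s≤s (s≤s z≤n)) (IsLargest.4≤m
          (largest _ k (s≤s (s≤s z≤n))
            [ 2≤nMUpTo (suc n) (n + 1) (m≤n+m 1 n) (≤-reflexive (+-comm n 1)) ])))
        (2≤f k)

  nM-rec : ∀ k → 1 < k →
           ∃ λ m → IsLargest ([_] ∘ nM f) k m × nM f k ≡ m ⊓∞ f k
  nM-rec 1 (s≤s ())
  nM-rec k@(suc (suc n)) 1<k =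
    _ , largest _ k 1<k [ 2≤nMUpTo (n + 1) (n + 1) (m≤n+m 1 n) ≤-refl ]
      , nM-unfold f {k} (s≤s z≤n)

N₁-rec : ∀ k → 1 < k →
         ∃ λ m → IsLargest ([_] ∘ N₁) k m × N₁ k ≡ m ⊓∞ [2,4,5,6,8,8] k
N₁-rec = nM-rec [2,4,5,6,8,8] 2≤f
  where
  2≤f : ∀ k → [ 2 ] ≤⁺ [2,4,5,6,8,8] k
  2≤f 0 = _ ≤⊤⁺
  2≤f 1 = [ ≤-refl ]
  2≤f 2 = [ m≤m+n 2 _ ]
  2≤f 3 = [ m≤m+n 2 _ ]
  2≤f 4 = [ m≤m+n 2 _ ]
  2≤f 5 = [ m≤m+n 2 _ ]
  2≤f 6 = [ m≤m+n 2 _ ]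
  2≤f (suc (suc (suc (suc (suc (suc (suc _))))))) = _ ≤⊤⁺

{-# OPTIONS --safe #-}
module Submission where

open import Data.Bool.Base using (Bool; true; false; not; _∧_; if_then_else_)
import Data.Bool.Properties as Bool
open import Data.Empty using (⊥)
open import Data.Fin.Base using (Fin; zero; suc)
import Data.Fin.Properties as Fin
open import Data.Fin.Subset using (Subset)
open import Data.Fin.Subset.Properties using (anySubset?)
import Data.Integer.Base as ℤ
import Data.Integer.Properties as ℤ
open import Data.List.Base using (List; []; _∷_; map; allFin; cartesianProduct)
import Data.List.Base as List
open import Data.List.Extrema.Nat using (min≤⊤; min≤xs)
import Data.List.Membership.DecPropositional as DecMembership
open import Data.List.Membership.Propositional using (find; lose)
import Data.List.Membership.Propositional as List
open import Data.List.Membership.Propositional.Properties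
  using (∈-allFin; ∈-cartesianProduct⁺; ∈-concatMap⁺; ∈-deduplicate⁺; ∈-lookup; ∈-map⁺)
open import Data.List.Relation.Unary.All as All using (All; []; _∷_)
open import Data.List.Relation.Unary.AllPairs using (AllPairs; _∷_)
open import Data.List.Relation.Unary.Any using (Any; here; there; index)
open import Data.List.Relation.Unary.Any.Properties using (lookup-index)
open import Data.List.Relation.Unary.Unique.DecPropositional.Properties using (deduplicate-!)
open import Data.Maybe.Base using (Maybe; just; nothing; is-just)
open import Data.Maybe.Properties using (just-injective) renaming (≡-dec to Maybe-≡-dec)
open import Data.Nat.Base using (ℕ; zero; suc; _+_; _*_; _∸_; _^_; _≤_; _<_; z≤n; s≤s)
open import Data.Nat.Induction using (<-rec)
open import Data.Nat.Properties
open import Data.Product.Base using (∃; ∃₂; _×_; _,_; proj₁; proj₂)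
open import Data.Sum.Base using (_⊎_; inj₁; inj₂; [_,_]′)
open import Data.Vec.Base using (lookup; replicate; tabulate; _[_]≔_)
open import Data.Vec.Properties using (lookup∘tabulate; lookup∘update; lookup∘update′)
open import Function.Base using (_∘_; id)
open import Relation.Binary.Construct.Add.Supremum.NonStrict _≤_ using ([_])
open import Relation.Binary.Definitions using (DecidableEquality)
open import Relation.Binary.PropositionalEquality
open import Relation.Nullary using (¬_; Dec; yes; no; contradiction; does)
open import Relation.Nullary.Decidable using (_×-dec_; _→-dec_; ¬?; dec-true; map′)
open import Defs

-- Saturate F by adding literal occurrences while it stays unsatisfiable; then
-- setting a literal of degree e to true gives a minimally unsatisfiable
-- clause-set of deficiency k + 1 - e in which no degree drops by more than e.
-- Applied to a variable v of minimal degree d this shows e ≤ k for both literal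
-- degrees of v (the deficiency is at least 1), and if d ≥ k + 2 it gives the
-- conditions of pdp, so that d is bounded by the recursion for nM.
--
-- It remains to exclude minimal degree 9 in deficiency 6, the smallest case
-- where the cap [2,4,5,6,8,8] improves on the recursion.  After the removal of
-- unit clauses, v has degree 9 with a literal a of degree 5 and its complement of degree 4.
-- (1) Setting the literal of degree 4 to true shows that two further variables
--     occur in all four clauses containing it.
-- (2) Setting a to true gives deficiency 2 and minimal degree 4.  A variable w of
--     degree 4 there has degree 9 in F; setting its literal of degree 5 in F to
--     true gives deficiency 1 and leaves only one variable of degree 2, since
--     two clauses clash at most once in deficiency 1.  Hence there is a unit
--     clause, which by (1) stems from a clause of F with exactly the variables
--     v, w, x, where w and x occur in all four clauses of (1).  Excluding x in
--     the same way yields a second unit clause on x, so F has only the variables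
--     v, w, x but 9 > 2³ clauses.

-- Finite subsets and their cardinalities.

private variable
  c n k m m′ : ℕ

-- Rows are clauses, columns are variables, and an entry is the sign with which the variable occurs.
-- Splitting keeps the matrix and shrinks a set `S` of rows and a set `T` of columns, so the index
-- types never change; dropping a column deletes that variable from all clauses.
Matrix : ℕ → ℕ → Set
Matrix c n = Fin c → Fin n → Maybe Bool

infix 4 _∈_ _∉_ _⊆_
infixl 7 _∩_ _∖_

-- Subsets are kept opaque so that unification can recover p and q from the
-- type i ∈ p ∩ q.
opaque
  Sub : ℕ → Set
  Sub n = Fin n → Bool

  _∈_ : Fin n → Sub n → Set
  i ∈ p = p i ≡ true

  _∩_ _∖_ : Sub n → Sub n → Sub n
  (p ∩ q) i = p i ∧ q i
  (p ∖ q) i = p i ∧ not (q i)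

  ⁅_⁆ : Fin n → Sub n
  ⁅ i ⁆ j = does (j Fin.≟ i)

  full : Sub n
  full _ = true

  Lit : Matrix c n → Fin n → Bool → Sub c
  Lit M v b i = does (Maybe-≡-dec Bool._≟_ (M i v) (just b))

  Occ : Matrix c n → Fin n → Sub c
  Occ M v i = is-just (M i v)

  cnt : Sub n → ℕ
  cnt {zero}  p = 0
  cnt {suc n} p = (if p zero then 1 else 0) + cnt {n} (p ∘ suc)

_∉_ : Fin n → Sub n → Set
i ∉ p = ¬ (i ∈ p)

_⊆_ : Sub n → Sub n → Set
p ⊆ q = ∀ {i} → i ∈ p → i ∈ q

opaque
  unfolding Sub

  _∈?_ : ∀ (i : Fin n) p → Dec (i ∈ p)
  i ∈? p = p i Bool.≟ true

  ∈∩⁺ : ∀ {p q : Sub n} {i} → i ∈ p → i ∈ q → i ∈ p ∩ q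
  ∈∩⁺ i∈p i∈q rewrite i∈p = i∈q

  ∈∩⁻ : ∀ {p q : Sub n} {i} → i ∈ p ∩ q → i ∈ p × i ∈ q
  ∈∩⁻ {p = p} {q} {i} h with p i | q i
  ... | true | true = refl , refl

  ∈∖⁺ : ∀ {p q : Sub n} {i} → i ∈ p → i ∉ q → i ∈ p ∖ q
  ∈∖⁺ {q = q} {i} i∈p i∉q rewrite i∈p with q i
  ... | true  = contradiction refl i∉q
  ... | false = refl

  ∈∖⁻ : ∀ {p q : Sub n} {i} → i ∈ p ∖ q → i ∈ p × i ∉ q
  ∈∖⁻ {p = p} {q} {i} h with p i | q i
  ... | true | false = refl , λ ()

  ∈⁅⁆⁻ : ∀ {i j : Fin n} → j ∈ ⁅ i ⁆ → j ≡ i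
  ∈⁅⁆⁻ {i = i} {j} h with j Fin.≟ i
  ... | yes eq = eq

  ∈⁅⁆⁺ : ∀ (i : Fin n) → i ∈ ⁅ i ⁆
  ∈⁅⁆⁺ i = dec-true (i Fin.≟ i) refl

  ∈full : ∀ (i : Fin n) → i ∈ full
  ∈full i = refl

  ∈Lit⁺ : ∀ {M : Matrix c n} {i v b} → M i v ≡ just b → i ∈ Lit M v b
  ∈Lit⁺ {M = M} {i} {v} {b} = dec-true (Maybe-≡-dec Bool._≟_ (M i v) (just b))

  ∈Lit⁻ : ∀ {M : Matrix c n} {i v b} → i ∈ Lit M v b → M i v ≡ just b
  ∈Lit⁻ {M = M} {i} {v} {b} h with Maybe-≡-dec Bool._≟_ (M i v) (just b)
  ... | yes eq = eq

  ∈Occ⁺ : ∀ {M : Matrix c n} {i v b} → M i v ≡ just b → i ∈ Occ M v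
  ∈Occ⁺ eq rewrite eq = refl

  ∈Occ⁻ : ∀ {M : Matrix c n} {i v} → i ∈ Occ M v → ∃ λ b → M i v ≡ just b
  ∈Occ⁻ {M = M} {i} {v} h with M i v
  ... | just b = b , refl

  cnt-mono : ∀ {p q : Sub n} → p ⊆ q → cnt p ≤ cnt q
  cnt-mono {zero}  p⊆q = z≤n
  cnt-mono {suc n} {p} {q} p⊆q =
    +-mono-≤ (head (p⊆q {zero})) (cnt-mono {n} {p ∘ suc} {q ∘ suc} λ {i} → p⊆q {suc i})
    where
    head : (p zero ≡ true → q zero ≡ true) →
           (if p zero then 1 else 0) ≤ (if q zero then 1 else 0)
    head h with p zero | q zero
    ... | false | _     = z≤n
    ... | true  | true  = ≤-refl
    ... | true  | false = contradiction (h refl) λ ()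

  cnt-partition : ∀ (p q : Sub n) → cnt p ≡ cnt (p ∩ q) + cnt (p ∖ q)
  cnt-partition {zero}  p q = refl
  cnt-partition {suc n} p q with p zero | q zero
  ... | false | _     = cnt-partition {n} (p ∘ suc) (q ∘ suc)
  ... | true  | true  = cong suc (cnt-partition {n} (p ∘ suc) (q ∘ suc))
  ... | true  | false = trans (cong suc (cnt-partition {n} (p ∘ suc) (q ∘ suc)))
                              (sym (+-suc _ _))

  cnt-∃ : ∀ {p : Sub n} → 1 ≤ cnt p → ∃ (_∈ p)
  cnt-∃ {suc n} {p} 1≤ with p zero in eq
  ... | true  = zero , eq
  ... | false = let i , i∈p = cnt-∃ {n} {p ∘ suc} 1≤ in suc i , i∈p

  cnt-pos : ∀ {p : Sub n} {i} → i ∈ p → 1 ≤ cnt p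
  cnt-pos {p = p} {zero}  i∈p rewrite i∈p = s≤s z≤n
  cnt-pos {suc n} {p} {suc i} i∈p = ≤-trans (cnt-pos {n} {p ∘ suc} {i} i∈p) (m≤n+m _ _)

  cnt-full : ∀ n → cnt (full {n}) ≡ n
  cnt-full zero    = refl
  cnt-full (suc n) = cong suc (cnt-full n)

  cnt-⁅⁆ : ∀ (i : Fin n) → cnt ⁅ i ⁆ ≡ 1
  cnt-⁅⁆ {suc n} zero = cong suc (cnt-none n)
    where
    cnt-none : ∀ n → cnt {n} (λ _ → false) ≡ 0
    cnt-none zero    = refl
    cnt-none (suc n) = cnt-none n
  cnt-⁅⁆ {suc n} (suc i) = trans
    (≤-antisym
      (cnt-mono {n} {⁅ suc i ⁆ ∘ suc} {⁅ i ⁆} λ {j} h →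
        subst (_∈ ⁅ i ⁆) (sym (Fin.suc-injective (∈⁅⁆⁻ {i = suc i} {suc j} h))) (∈⁅⁆⁺ i))
      (cnt-mono {n} {⁅ i ⁆} {⁅ suc i ⁆ ∘ suc} λ {j} h →
        subst (λ x → suc x ∈ ⁅ suc i ⁆) (sym (∈⁅⁆⁻ {i = i} {j} h)) (∈⁅⁆⁺ (suc i))))
    (cnt-⁅⁆ i)

cnt-cong : ∀ {p q : Sub n} → p ⊆ q → q ⊆ p → cnt p ≡ cnt q
cnt-cong p⊆q q⊆p = ≤-antisym (cnt-mono p⊆q) (cnt-mono q⊆p)

∈-remove⁺ : ∀ {p : Sub n} {i j} → j ∈ p → j ≢ i → j ∈ p ∖ ⁅ i ⁆
∈-remove⁺ j∈p j≢i = ∈∖⁺ j∈p (j≢i ∘ ∈⁅⁆⁻)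

∈-remove⁻ : ∀ {p : Sub n} {i j} → j ∈ p ∖ ⁅ i ⁆ → j ∈ p × j ≢ i
∈-remove⁻ {i = i} h with ∈∖⁻ h
... | j∈p , j∉ = j∈p , λ { refl → j∉ (∈⁅⁆⁺ i) }

cnt-empty : ∀ {p : Sub n} → (∀ i → i ∉ p) → cnt p ≡ 0
cnt-empty {p = p} empty with cnt p in eq
... | zero  = refl
... | suc x = contradiction (proj₂ i∈p) (empty (proj₁ i∈p))
  where i∈p = cnt-∃ (subst (1 ≤_) (sym eq) (s≤s z≤n))

cnt-≥⇒⊇ : ∀ {p q : Sub n} → p ⊆ q → cnt q ≤ cnt p → q ⊆ p
cnt-≥⇒⊇ {p = p} {q} p⊆q q≤p {i} i∈q with i ∈? p
... | yes i∈p = i∈p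
... | no  i∉p = contradiction q≤p (<⇒≱ (begin-strict
  cnt p                        ≤⟨ cnt-mono (λ j∈p → ∈∩⁺ (p⊆q j∈p) j∈p) ⟩
  cnt (q ∩ p)                  ≡⟨ +-identityʳ _ ⟨
  cnt (q ∩ p) + 0              <⟨ +-monoʳ-< _ (cnt-pos (∈∖⁺ i∈q i∉p)) ⟩
  cnt (q ∩ p) + cnt (q ∖ p)    ≡⟨ cnt-partition q p ⟨
  cnt q                        ∎))
  where open ≤-Reasoning

cnt-remove : ∀ {p : Sub n} {i} → i ∈ p → cnt p ≡ suc (cnt (p ∖ ⁅ i ⁆))
cnt-remove {p = p} {i} i∈p = trans (cnt-partition p ⁅ i ⁆) (cong (_+ cnt (p ∖ ⁅ i ⁆))
  (trans (cnt-cong (proj₂ ∘ ∈∩⁻)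
    (λ j∈ → ∈∩⁺ (subst (_∈ p) (sym (∈⁅⁆⁻ j∈)) i∈p) j∈))
  (cnt-⁅⁆ i)))

cnt≤suc-remove : ∀ (p : Sub n) i → cnt p ≤ suc (cnt (p ∖ ⁅ i ⁆))
cnt≤suc-remove p i with i ∈? p
... | yes i∈p = ≤-reflexive (cnt-remove i∈p)
... | no  i∉p = m≤n⇒m≤1+n (cnt-mono λ j∈p → ∈-remove⁺ j∈p λ { refl → i∉p j∈p })

unique : ∀ {p : Sub n} → cnt p ≤ 1 → ∀ {i j} → i ∈ p → j ∈ p → i ≡ j
unique p≤1 {i} {j} i∈p j∈p with i Fin.≟ j
... | yes eq = eq
... | no i≢j = contradiction (≤-trans (≤-reflexive (sym (cnt-remove j∈p))) p≤1)
  (<⇒≱ (s≤s (cnt-pos (∈-remove⁺ i∈p i≢j))))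

pair : ∀ {p : Sub n} → cnt p ≤ 2 → ∀ {i j k} →
       i ∈ p → j ∈ p → i ≢ j → k ∈ p → k ≢ i → k ≡ j
pair p≤2 i∈p j∈p i≢j k∈p k≢i =
  unique (≤-pred (subst (_≤ 2) (cnt-remove i∈p) p≤2))
    (∈-remove⁺ k∈p k≢i) (∈-remove⁺ j∈p (i≢j ∘ sym))

cnt≤2 : ∀ {p : Sub n} i j → (∀ {k} → k ∈ p → k ≡ i ⊎ k ≡ j) → cnt p ≤ 2
cnt≤2 {p = p} i j h = begin
  cnt p                                ≤⟨ cnt≤suc-remove p i ⟩
  suc (cnt (p ∖ ⁅ i ⁆))                ≤⟨ s≤s (cnt≤suc-remove (p ∖ ⁅ i ⁆) j) ⟩
  2 + cnt (p ∖ ⁅ i ⁆ ∖ ⁅ j ⁆)          ≡⟨ cong (2 +_) (cnt-empty empty) ⟩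
  2                                    ∎
  where
  open ≤-Reasoning
  empty : ∀ k → k ∉ p ∖ ⁅ i ⁆ ∖ ⁅ j ⁆
  empty k k∈ with ∈-remove⁻ k∈
  ... | k∈′ , k≢j with ∈-remove⁻ k∈′
  ...   | k∈p , k≢i = [ k≢i , k≢j ]′ (h k∈p)

argmin : ∀ {p : Sub n} (f : Fin n → ℕ) → ∃ (_∈ p) →
         ∃ λ i → i ∈ p × (∀ {j} → j ∈ p → f i ≤ f j)
argmin {n} {p} f (i₀ , i₀∈p) = <-rec P step (f i₀) i₀ refl i₀∈p
  where
  P : ℕ → Set
  P x = ∀ i → f i ≡ x → i ∈ p → ∃ λ i → i ∈ p × (∀ {j} → j ∈ p → f i ≤ f j)
  step : ∀ x → (∀ {y} → y < x → P y) → P x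
  step x rec i refl i∈p with Fin.any? (λ j → (j ∈? p) ×-dec (f j <? f i))
  ... | yes (j , j∈p , fj<fi) = rec fj<fi j refl j∈p
  ... | no  none = i , i∈p , λ {j} j∈p → ≮⇒≥ λ fj<fi → none (j , j∈p , fj<fi)

-- Minimal unsatisfiability and saturation.

record Satisfies (M : Matrix c n) (T : Sub n) (i : Fin c) (φ : Subset n) : Set where
  constructor via
  field
    v     : Fin n
    v∈T   : v ∈ T
    holds : M i v ≡ just (lookup φ v)

AllBut : Matrix c n → Sub c → Sub n → Fin c → Subset n → Set
AllBut M S T i φ = ∀ k → k ∈ S → k ≢ i → Satisfies M T k φ

record MU (M : Matrix c n) (S : Sub c) (T : Sub n) : Set where
  field
    unsat    : ∀ φ → ∃ λ i → i ∈ S × ¬ Satisfies M T i φ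
    critical : ∀ {i} → i ∈ S → ∃ (AllBut M S T i)

  allBut-fails : ∀ {i φ} → AllBut M S T i φ → ¬ Satisfies M T i φ
  allBut-fails {i} {φ} rest sat with unsat φ
  ... | k , k∈S , ¬sat with k Fin.≟ i
  ...   | yes refl = ¬sat sat
  ...   | no  k≢i  = ¬sat (rest k k∈S k≢i)

open MU

-- The assignment `φ` shows that adding the literal with sign `b` on `j` to clause `i` would make
-- the clause-set satisfiable.
record Saturated (M : Matrix c n) (S : Sub c) (T : Sub n) : Set where
  constructor saturated
  field
    blocked : ∀ {i j b} → i ∈ S → j ∈ T → M i j ≢ just b →
              ∃ λ φ → AllBut M S T i φ × lookup φ j ≡ b

open Saturated

infix 4 _⊑_
record _⊑_ (M N : Matrix c n) : Set where
  constructor extends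
  field
    literal : ∀ {i j b} → M i j ≡ just b → N i j ≡ just b

open _⊑_

⊑-refl : ∀ {M : Matrix c n} → M ⊑ M
⊑-refl = extends id

⊑-trans : ∀ {M N N′ : Matrix c n} → M ⊑ N → N ⊑ N′ → M ⊑ N′
⊑-trans p q = extends (literal q ∘ literal p)

⊑-nothing : ∀ {M N : Matrix c n} {i j} → M ⊑ N → N i j ≡ nothing → M i j ≡ nothing
⊑-nothing {M = M} {i = i} {j} M⊑N eq with M i j in eq′
... | nothing = refl
... | just b  = contradiction (trans (sym eq) (literal M⊑N eq′)) λ ()

satisfies? : ∀ (M : Matrix c n) T i φ → Dec (Satisfies M T i φ)
satisfies? M T i φ = map′
  (λ (j , j∈T , eq) → via j j∈T eq) (λ (via j j∈T eq) → j , j∈T , eq)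
  (Fin.any? λ j → (j ∈? T) ×-dec Maybe-≡-dec Bool._≟_ (M i j) (just (lookup φ j)))

allBut? : ∀ (M : Matrix c n) S T i φ → Dec (AllBut M S T i φ)
allBut? M S T i φ = Fin.all? λ k → (k ∈? S) →-dec (¬? (k Fin.≟ i) →-dec satisfies? M T k φ)

module _ {M N : Matrix c n} {S : Sub c} {T : Sub n} (M⊑N : M ⊑ N) where

  satisfies-⊑ : ∀ {i φ} → Satisfies M T i φ → Satisfies N T i φ
  satisfies-⊑ (via j j∈T eq) = via j j∈T (literal M⊑N eq)

  allBut-⊑ : ∀ {i φ} → AllBut M S T i φ → AllBut N S T i φ
  allBut-⊑ rest k k∈S k≢i = satisfies-⊑ (rest k k∈S k≢i)

add : Matrix c n → Fin c → Fin n → Bool → Matrix c n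
add M i j b k l with k Fin.≟ i | l Fin.≟ j
... | yes _ | yes _ = just b
... | yes _ | no  _ = M k l
... | no  _ | _     = M k l

⊑-add : ∀ {M : Matrix c n} {i j b} → M i j ≡ nothing → M ⊑ add M i j b
⊑-add {M = M} {i} {j} {b} none = extends keep
  where
  keep : ∀ {k l b′} → M k l ≡ just b′ → add M i j b k l ≡ just b′
  keep {k} {l} eq with k Fin.≟ i | l Fin.≟ j
  ... | yes refl | yes refl = contradiction (trans (sym none) eq) λ ()
  ... | yes _    | no _     = eq
  ... | no _     | _        = eq

add-satisfies : ∀ {M : Matrix c n} {T i j b k φ} → Satisfies (add M i j b) T k φ →
                Satisfies M T k φ ⊎ k ≡ i × lookup φ j ≡ b
add-satisfies {i = i} {j} {k = k} (via l l∈T eq) with k Fin.≟ i | l Fin.≟ j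
... | yes refl | yes refl = inj₂ (refl , sym (just-injective eq))
... | yes _    | no _     = inj₁ (via l l∈T eq)
... | no _     | _        = inj₁ (via l l∈T eq)

Blocked : Matrix c n → Sub c → Sub n → Fin c × Fin n × Bool → Set
Blocked M S T (i , j , b) = i ∈ S → j ∈ T → M i j ≢ just b →
                            ∃ λ φ → AllBut M S T i φ × lookup φ j ≡ b

add-here : ∀ (M : Matrix c n) i j b → add M i j b i j ≡ just b
add-here M i j b with i Fin.≟ i | j Fin.≟ j
... | yes _  | yes _  = refl
... | no i≢i | _      = contradiction refl i≢i
... | yes _  | no j≢j = contradiction refl j≢j

≢-≢⇒≡ : ∀ {x y z : Bool} → x ≢ z → y ≢ z → x ≡ y
≢-≢⇒≡ x≢z y≢z = trans (Bool.¬-not x≢z) (sym (Bool.¬-not y≢z))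

module _ {S : Sub c} {T : Sub n} where

  -- If no assignment as required exists and the entry is empty, adding the literal keeps
  -- unsatisfiability. If the opposite literal is already there, any assignment witnessing that `i`
  -- is critical falsifies it and so gives `j` the value `b`.
  block : ∀ {M} → MU M S T → ∀ x → ∃ λ N → M ⊑ N × MU N S T × Blocked N S T x
  block {M} mu (i , j , b)
    with i ∈? S | anySubset? (λ φ → allBut? M S T i φ ×-dec (lookup φ j Bool.≟ b))
  ... | no i∉S  | _      = M , ⊑-refl , mu , λ i∈S → contradiction i∈S i∉S
  ... | yes _   | yes h  = M , ⊑-refl , mu , λ _ _ _ → h
  ... | yes i∈S | no h with M i j in eq
  ...   | just b′ = M , ⊑-refl , mu , λ _ j∈T Mij≢ →
    let φ , rest = critical mu i∈S in
    φ , rest , ≢-≢⇒≡ {z = b′}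
      (λ φj≡b′ → allBut-fails mu rest (via j j∈T (trans eq (cong just (sym φj≡b′)))))
      (λ b≡b′ → Mij≢ (trans eq (cong just (sym b≡b′))))
  ... | nothing = add M i j b , ⊑-add eq , mu′ , λ _ _ Mij≢ → contradiction (add-here M i j b) Mij≢
    where
    mu′ : MU (add M i j b) S T
    mu′ .critical k∈S = let φ , rest = critical mu k∈S in φ , allBut-⊑ (⊑-add eq) rest
    mu′ .unsat φ with allBut? M S T i φ | lookup φ j Bool.≟ b
    ... | yes rest | yes φj≡b = contradiction (φ , rest , φj≡b) h
    ... | yes rest | no  φj≢b = i , i∈S , λ sat →
      [ allBut-fails mu rest , φj≢b ∘ proj₂ ]′ (add-satisfies sat)
    ... | no ¬rest | _ with Fin.any? (λ k → (k ∈? S) ×-dec ¬? (k Fin.≟ i) ×-dec ¬? (satisfies? M T k φ))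
    ...   | yes (k , k∈S , k≢i , ¬sat) = k , k∈S , λ sat →
      [ ¬sat , k≢i ∘ proj₁ ]′ (add-satisfies sat)
    ...   | no none = contradiction rest ¬rest
      where
      rest : AllBut M S T i φ
      rest k k∈S k≢i with satisfies? M T k φ
      ... | yes sat = sat
      ... | no ¬sat = contradiction (k , k∈S , k≢i , ¬sat) none

  -- A witness for `Blocked` survives every extension of the matrix, so a single pass over all
  -- triples saturates.
  blockAll : ∀ {M} → MU M S T → ∀ xs → ∃ λ N → M ⊑ N × MU N S T × All (Blocked N S T) xs
  blockAll mu []       = _ , ⊑-refl , mu , []
  blockAll mu (x ∷ xs) with block mu x
  ... | N , M⊑N , mu′ , x-blocked with blockAll mu′ xs
  ...   | N′ , N⊑N′ , mu″ , all = N′ , ⊑-trans M⊑N N⊑N′ , mu″ ,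
    (λ i∈S j∈T ≢b → let φ , rest , φj≡b = x-blocked i∈S j∈T (≢b ∘ literal N⊑N′)
                    in φ , allBut-⊑ N⊑N′ rest , φj≡b) ∷ all

  saturate : ∀ {M} → MU M S T → ∃ λ N → M ⊑ N × MU N S T × Saturated N S T
  saturate mu =
    let N , M⊑N , mu′ , all = blockAll mu (cartesianProduct (allFin _)
          (cartesianProduct (allFin _) (true ∷ false ∷ [])))
    in N , M⊑N , mu′ , saturated λ {i} {j} {b} → All.lookup all
      (∈-cartesianProduct⁺ (∈-allFin i) (∈-cartesianProduct⁺ (∈-allFin j) (∈bools b)))
    where
    ∈bools : ∀ b → b List.∈ true ∷ false ∷ []
    ∈bools true  = here refl
    ∈bools false = there (here refl)

-- Splitting on a variable.

lookup-flip : ∀ (φ : Subset n) {v w b} → w ≢ v → lookup (φ [ v ]≔ b) w ≡ lookup φ w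
lookup-flip φ w≢v = lookup∘update′ w≢v φ _

module _ {M : Matrix c n} {S : Sub c} {T : Sub n} where

  -- A literal whose complement does not occur could be made true for free.
  complement-occurs : MU M S T → ∀ {i v b} → i ∈ S → v ∈ T → M i v ≡ just b →
                      ∃ λ k → k ∈ S × M k v ≡ just (not b)
  complement-occurs mu {i} {v} {b} i∈S v∈T eq with critical mu i∈S
  ... | φ , rest with unsat mu (φ [ v ]≔ b)
  ...   | k , k∈S , ¬sat with rest k k∈S k≢i
    where
    k≢i : k ≢ i
    k≢i refl = ¬sat (via v v∈T (trans eq (cong just (sym (lookup∘update v φ b)))))
  ...     | via j j∈T eq′ with j Fin.≟ v
  ...       | no j≢v = contradiction
    (via j j∈T (trans eq′ (cong just (sym (lookup-flip φ j≢v))))) ¬sat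
  ...       | yes refl with lookup φ v Bool.≟ b
  ...         | no  φv≢b = k , k∈S , trans eq′ (cong just (Bool.¬-not φv≢b))
  ...         | yes refl = contradiction
    (via v v∈T (trans eq′ (cong just (sym (lookup∘update v φ b))))) ¬sat

  -- Saturation keeps the remaining clauses critical: it provides an assignment with value `b` at
  -- `v` that satisfies all clauses but `i`. No clause outside `Lit M v b` is satisfied through `v`
  -- itself, so the assignment still works once `v` is deleted.
  split-MU : MU M S T → Saturated M S T → ∀ {v} → v ∈ T → ∀ b →
             MU M (S ∖ Lit M v b) (T ∖ ⁅ v ⁆)
  split-MU mu sat {v} v∈T b .unsat φ with unsat mu (φ [ v ]≔ b)
  ... | i , i∈S , ¬sat = i
    , ∈∖⁺ i∈S (λ i∈L → ¬sat (via v v∈T (trans (∈Lit⁻ i∈L) (cong just (sym (lookup∘update v φ b))))))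
    , λ (via j j∈ eq) → let j∈T , j≢v = ∈-remove⁻ j∈ in
        ¬sat (via j j∈T (trans eq (cong just (sym (lookup-flip φ j≢v)))))
  split-MU mu sat {v} v∈T b .critical {i} i∈ with ∈∖⁻ i∈
  ... | i∈S , i∉L with blocked sat i∈S v∈T (i∉L ∘ ∈Lit⁺)
  ...   | φ , rest , refl = φ , λ k k∈ k≢i → let k∈S , k∉L = ∈∖⁻ k∈ in restrict k∉L (rest k k∈S k≢i)
    where
    restrict : ∀ {k} → k ∉ Lit M v (lookup φ v) → Satisfies M T k φ → Satisfies M (T ∖ ⁅ v ⁆) k φ
    restrict k∉L (via j j∈T eq) = via j (∈-remove⁺ j∈T λ { refl → k∉L (∈Lit⁺ eq) }) eq

-- Degrees and their loss when clauses are removed.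

deg : Matrix c n → Sub c → Fin n → ℕ
deg M S v = cnt (S ∩ Occ M v)

ldeg : Matrix c n → Sub c → Fin n → Bool → ℕ
ldeg M S v b = cnt (S ∩ Lit M v b)

private variable
  M N : Matrix c n
  S L : Sub c
  T : Sub n
  v : Fin n

deg≡ldeg+ldeg : ∀ (M : Matrix c n) S v b → deg M S v ≡ ldeg M S v b + ldeg M S v (not b)
deg≡ldeg+ldeg M S v b = trans (cnt-partition (S ∩ Occ M v) (Lit M v b)) (cong₂ _+_
  (cnt-cong (λ h → let h′ , ∈L = ∈∩⁻ h in ∈∩⁺ (proj₁ (∈∩⁻ h′)) ∈L)
            (λ h → let ∈S , ∈L = ∈∩⁻ h in ∈∩⁺ (∈∩⁺ ∈S (∈Occ⁺ (∈Lit⁻ ∈L))) ∈L))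
  (cnt-cong
    (λ h → let h′ , ∉L = ∈∖⁻ h ; ∈S , ∈O = ∈∩⁻ h′ ; b′ , eq = ∈Occ⁻ ∈O in
      ∈∩⁺ ∈S (∈Lit⁺ (trans eq (cong just (Bool.¬-not λ b′≡b → ∉L (∈Lit⁺ (trans eq (cong just b′≡b))))))))
    (λ h → let ∈S , ∈L = ∈∩⁻ h in
      ∈∖⁺ (∈∩⁺ ∈S (∈Occ⁺ (∈Lit⁻ ∈L)))
        (λ ∈L′ → Bool.not-¬ {b} refl
          (just-injective (trans (sym (∈Lit⁻ ∈L′)) (∈Lit⁻ ∈L)))))))

cnt-∩-partition : ∀ (S A L : Sub c) → cnt (S ∩ A) ≡ cnt ((S ∖ L) ∩ A) + cnt ((S ∩ L) ∩ A)
cnt-∩-partition S A L = trans (cnt-partition (S ∩ A) L) (trans (+-comm (cnt (S ∩ A ∩ L)) _) (cong₂ _+_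
  (cnt-cong (λ h → let h′ , ∉L = ∈∖⁻ h ; ∈S , ∈A = ∈∩⁻ h′ in ∈∩⁺ (∈∖⁺ ∈S ∉L) ∈A)
            (λ h → let h′ , ∈A = ∈∩⁻ h ; ∈S , ∉L = ∈∖⁻ h′ in ∈∖⁺ (∈∩⁺ ∈S ∈A) ∉L))
  (cnt-cong (λ h → let h′ , ∈L = ∈∩⁻ h ; ∈S , ∈A = ∈∩⁻ h′ in ∈∩⁺ (∈∩⁺ ∈S ∈L) ∈A)
            (λ h → let h′ , ∈A = ∈∩⁻ h ; ∈S , ∈L = ∈∩⁻ h′ in ∈∩⁺ (∈∩⁺ ∈S ∈A) ∈L))))

deg-drop : ∀ (M : Matrix c n) S L v → deg M S v ≤ deg M (S ∖ L) v + cnt (S ∩ L)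
deg-drop M S L v = ≤-trans (≤-reflexive (cnt-∩-partition S (Occ M v) L))
  (+-monoʳ-≤ _ (cnt-mono (proj₁ ∘ ∈∩⁻)))

-- The equality case of `deg-drop`: a degree can fall by the full number of removed clauses only if
-- each of them contains the variable.
deg-drop-all : deg M (S ∖ L) v + cnt (S ∩ L) ≤ deg M S v → S ∩ L ⊆ Occ M v
deg-drop-all {M = M} {S = S} {L = L} {v = v} h i∈ =
  proj₂ (∈∩⁻ (cnt-≥⇒⊇ (proj₁ ∘ ∈∩⁻)
    (+-cancelˡ-≤ (deg M (S ∖ L) v) _ _
      (≤-trans h (≤-reflexive (cnt-∩-partition S (Occ M v) L)))) i∈))

deg-mono-⊑ : M ⊑ N → deg M S v ≤ deg N S v
deg-mono-⊑ M⊑N = cnt-mono λ h → let ∈S , ∈O = ∈∩⁻ h in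
  ∈∩⁺ ∈S (∈Occ⁺ (literal M⊑N (proj₂ (∈Occ⁻ ∈O))))

literals-occur : MU M S T → v ∈ T → 1 ≤ deg M S v → ∀ b → 1 ≤ ldeg M S v b
literals-occur mu v∈T 1≤deg b with cnt-∃ 1≤deg
... | i , h with ∈∩⁻ h
...   | i∈S , ∈O with ∈Occ⁻ ∈O
...     | b′ , eq with b′ Bool.≟ b
...       | yes refl = cnt-pos (∈∩⁺ i∈S (∈Lit⁺ eq))
...       | no b′≢b with complement-occurs mu i∈S v∈T eq
...         | k , k∈S , eq′ = cnt-pos (∈∩⁺ k∈S
  (∈Lit⁺ (trans eq′ (cong just (sym (Bool.¬-not (b′≢b ∘ sym)))))))

-- Tarsi's lemma and the exponential bound on the number of clauses.

-- Induction on the number of variables: saturate, then set to true a literal of a variable `v` of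
-- minimal degree. Both literals of `v` occur, so at least one clause disappears, but fewer than the
-- degree of `v`; hence every other variable still occurs.
tarsi : MU M S T → (∀ {j} → j ∈ T → 1 ≤ deg M S j) → cnt T < cnt S
tarsi = λ mu 1≤deg → rec _ refl mu 1≤deg
  where
  rec : ∀ t {c n} {M : Matrix c n} {S T} → cnt T ≡ t → MU M S T →
        (∀ {j} → j ∈ T → 1 ≤ deg M S j) → cnt T < cnt S
  rec zero    {S = S} {T} t≡ mu 1≤deg = subst (_< cnt S) (sym t≡)
    (let _ , i∈S , _ = unsat mu (replicate _ true) in cnt-pos i∈S)
  rec (suc t) {S = S} {T} t≡ mu 1≤deg with saturate mu
  ... | N , M⊑N , mu′ , sat
    with argmin (deg N S) (cnt-∃ (subst (1 ≤_) (sym t≡) (s≤s z≤n)))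
  ...   | v , v∈T , least = begin-strict
    cnt T                                            ≡⟨ cnt-remove v∈T ⟩
    1 + cnt (T ∖ ⁅ v ⁆)                              <⟨ +-mono-≤-< (1≤ldeg true)
                                                        (rec t (suc-injective (trans (sym (cnt-remove v∈T)) t≡))
                                                          (split-MU mu′ sat v∈T true) remaining) ⟩
    ldeg N S v true + cnt (S ∖ Lit N v true)         ≡⟨ cnt-partition S (Lit N v true) ⟨
    cnt S                                            ∎
    where
    open ≤-Reasoning
    1≤ldeg = literals-occur mu′ v∈T (≤-trans (1≤deg v∈T) (deg-mono-⊑ M⊑N))
    remaining : ∀ {j} → j ∈ T ∖ ⁅ v ⁆ → 1 ≤ deg N (S ∖ Lit N v true) j
    remaining {j} j∈ = +-cancelʳ-≤ (ldeg N S v true) _ _ (begin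
      1 + ldeg N S v true                                      ≡⟨ +-comm 1 _ ⟩
      ldeg N S v true + 1                                      ≤⟨ +-monoʳ-≤ _ (1≤ldeg false) ⟩
      ldeg N S v true + ldeg N S v false                       ≡⟨ deg≡ldeg+ldeg N S v true ⟨
      deg N S v                                                ≤⟨ least (proj₁ (∈-remove⁻ j∈)) ⟩
      deg N S j                                                ≤⟨ deg-drop N S (Lit N v true) j ⟩
      deg N (S ∖ Lit N v true) j + ldeg N S v true             ∎)

-- After saturation both splits on `v` are minimally unsatisfiable, and every clause survives in at
-- least one of them. Without variables there is only one clause, since a second one would have to
-- be satisfied.
cnt≤2^cnt : MU M S T → cnt S ≤ 2 ^ cnt T
cnt≤2^cnt = λ mu → rec _ refl mu
  where
  open ≤-Reasoning
  rec : ∀ t {c n} {M : Matrix c n} {S T} → cnt T ≡ t → MU M S T → cnt S ≤ 2 ^ cnt T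
  rec zero {S = S} {T} t≡ mu = subst (λ t → cnt S ≤ 2 ^ t) (sym t≡) (begin
    cnt S                  ≡⟨ cnt-remove i∈S ⟩
    suc (cnt (S ∖ ⁅ i ⁆))  ≡⟨ cong suc (cnt-empty others) ⟩
    1                      ∎)
    where
    i = proj₁ (unsat mu (replicate _ true))
    i∈S = proj₁ (proj₂ (unsat mu (replicate _ true)))
    others : ∀ k → k ∉ S ∖ ⁅ i ⁆
    others k k∈ with ∈-remove⁻ k∈
    ... | k∈S , k≢i with proj₂ (critical mu i∈S) k k∈S k≢i
    ...   | via j j∈T _ = contradiction (subst (1 ≤_) t≡ (cnt-pos j∈T)) λ ()
  rec (suc t) {S = S} {T} t≡ mu with saturate mu
  ... | N , _ , mu′ , sat with cnt-∃ (subst (1 ≤_) (sym t≡) (s≤s z≤n))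
  ...   | v , v∈T = begin
    cnt S                                                        ≡⟨ cnt-partition S (Lit N v true) ⟩
    ldeg N S v true + cnt (S ∖ Lit N v true) ≤⟨ +-mono-≤ (cnt-mono disjoint) ≤-refl ⟩
    cnt (S ∖ Lit N v false) + cnt (S ∖ Lit N v true) ≤⟨ +-mono-≤ (half false) (half true) ⟩
    2 ^ cnt (T ∖ ⁅ v ⁆) + 2 ^ cnt (T ∖ ⁅ v ⁆) ≡⟨ cong (2 ^ cnt (T ∖ ⁅ v ⁆) +_) (+-identityʳ _) ⟨
    2 ^ suc (cnt (T ∖ ⁅ v ⁆))                                    ≡⟨ cong (2 ^_) (cnt-remove v∈T) ⟨
    2 ^ cnt T                                                    ∎
    where
    half = λ b → rec t (suc-injective (trans (sym (cnt-remove v∈T)) t≡)) (split-MU mu′ sat v∈T b)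
    disjoint : S ∩ Lit N v true ⊆ S ∖ Lit N v false
    disjoint h = let ∈S , ∈L = ∈∩⁻ h in ∈∖⁺ ∈S λ ∈L′ →
      contradiction (trans (sym (∈Lit⁻ ∈L)) (∈Lit⁻ ∈L′)) λ ()

-- Deficiency and minimal degree under splitting.

-- `k` is the deficiency; `m` is merely a lower bound of the degrees and holds vacuously for empty
-- `T`.
record MinUnsat (k m : ℕ) (M : Matrix c n) (S : Sub c) (T : Sub n) : Set where
  field
    mu      : MU M S T
    size    : cnt S ≡ cnt T + k
    degrees : ∀ {j} → j ∈ T → m ≤ deg M S j

  open MU mu public

open MinUnsat hiding (unsat; critical; allBut-fails)

weaken : m′ ≤ m → MinUnsat k m M S T → MinUnsat k m′ M S T
weaken m′≤m F = record
  { mu = mu F ; size = size F ; degrees = λ j∈T → ≤-trans m′≤m (degrees F j∈T) }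

saturateᵈ : MinUnsat k m M S T → ∃ λ N → M ⊑ N × MinUnsat k m N S T × Saturated N S T
saturateᵈ F with saturate (mu F)
... | N , M⊑N , mu′ , sat = N , M⊑N
  , record { mu = mu′ ; size = size F ; degrees = λ j∈T → ≤-trans (degrees F j∈T) (deg-mono-⊑ M⊑N) }
  , sat

-- Removing `e` clauses and one variable leaves deficiency `k + 1 - e`, which is at least 1 by
-- `tarsi`; hence it has the form `suc k′`.
splitAt : MinUnsat k m M S T → Saturated M S T → v ∈ T → ∀ b {e m′} → ldeg M S v b ≡ e →
          1 ≤ m′ → (∀ {j} → j ∈ T ∖ ⁅ v ⁆ → m′ ≤ deg M (S ∖ Lit M v b) j) →
          ∃ λ k′ → k ≡ e + k′ × MinUnsat (suc k′) m′ M (S ∖ Lit M v b) (T ∖ ⁅ v ⁆)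
splitAt {k = k} {M = M} {S} {T} {v} F sat v∈T b {e} refl 1≤m′ m′≤deg
  with m≤n⇒∃[o]m+o≡n (tarsi (split-MU (mu F) sat v∈T b) (≤-trans 1≤m′ ∘ m′≤deg))
... | k′ , eq = k′ , +-cancelˡ-≡ (suc t) _ _ (begin
    suc t + k                               ≡⟨ cong (_+ k) (cnt-remove v∈T) ⟨
    cnt T + k                               ≡⟨ size F ⟨
    cnt S                                   ≡⟨ cnt-partition S (Lit M v b) ⟩
    e + cnt (S ∖ Lit M v b)                 ≡⟨ cong (e +_) eq ⟨
    e + (suc t + k′)                        ≡⟨ +-assoc e (suc t) k′ ⟨
    e + suc t + k′                          ≡⟨ cong (_+ k′) (+-comm e (suc t)) ⟩
    suc t + e + k′                          ≡⟨ +-assoc (suc t) e k′ ⟩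
    suc t + (e + k′)                        ∎) , record
  { mu = split-MU (mu F) sat v∈T b ; size = trans (sym eq) (sym (+-suc t k′)) ; degrees = m′≤deg }
  where
  open ≡-Reasoning
  t = cnt (T ∖ ⁅ v ⁆)

-- Opaque, here and below, lest with-abstractions unfold the proofs.
opaque
  split : MinUnsat k m M S T → Saturated M S T → v ∈ T → ∀ b {e m′} → ldeg M S v b ≡ e →
          1 ≤ m′ → m′ + e ≤ m →
          ∃ λ k′ → k ≡ e + k′ × MinUnsat (suc k′) m′ M (S ∖ Lit M v b) (T ∖ ⁅ v ⁆)
  split {M = M} {S} F sat v∈T b eq 1≤m′ m′+e≤m = splitAt F sat v∈T b eq 1≤m′ λ {j} j∈ →
    +-cancelʳ-≤ (ldeg M S _ b) _ _ (≤-trans (≤-reflexive (cong (_ +_) eq))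
      (≤-trans m′+e≤m (≤-trans (degrees F (proj₁ (∈-remove⁻ j∈))) (deg-drop M S (Lit M _ b) j))))

opaque
  -- With `v` as the only variable there would be just `suc k` clauses, too few for degree `m`.
  another-var : MinUnsat k m M S T → v ∈ T → suc k < m → ∃ (_∈ T ∖ ⁅ v ⁆)
  another-var {k = k} {m} {M = M} {S} {T} {v} F v∈T k+1<m with 1 ≤? cnt (T ∖ ⁅ v ⁆)
  ... | yes 1≤ = cnt-∃ 1≤
  ... | no 1≰ = contradiction k+1<m (≤⇒≯ (begin
    m                            ≤⟨ degrees F v∈T ⟩
    deg M S v                    ≤⟨ cnt-mono (proj₁ ∘ ∈∩⁻) ⟩
    cnt S                        ≡⟨ size F ⟩
    cnt T + k                    ≡⟨ cong (_+ k) (cnt-remove v∈T) ⟩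
    suc (cnt (T ∖ ⁅ v ⁆)) + k    ≡⟨ cong (λ t → suc t + k) (n<1⇒n≡0 (≰⇒> 1≰)) ⟩
    suc k                        ∎))
    where open ≤-Reasoning

-- Saturation may raise the minimal degree, so the lower bound becomes the degree of `w` in `M′`
-- instead of `m`.
record Pivot (k m : ℕ) (M : Matrix c n) (S : Sub c) (T : Sub n) : Set where
  field
    {M′}     : Matrix c n
    M⊑M′     : M ⊑ M′
    isSat    : Saturated M′ S T
    w        : Fin n
    w∈T      : w ∈ T
    m≤deg    : m ≤ deg M′ S w
    minUnsat : MinUnsat k (deg M′ S w) M′ S T

module LiteralDegrees (F : MinUnsat k m M S T) (sat : Saturated M S T) (v∈T : v ∈ T)
                      (deg≡m : deg M S v ≡ m) (1≤m : 1 ≤ m) where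

  ldeg-sum : ∀ b → ldeg M S v b + ldeg M S v (not b) ≡ m
  ldeg-sum b = trans (sym (deg≡ldeg+ldeg M S v b)) deg≡m

  1≤ldeg : ∀ b → 1 ≤ ldeg M S v b
  1≤ldeg = literals-occur (mu F) v∈T (≤-trans 1≤m (degrees F v∈T))

  -- Every degree is at least `m` and drops by at most the degree of the literal set to true; the
  -- difference is the degree of the other literal.
  splitAtMin : ∀ b → ∃ λ k′ → k ≡ ldeg M S v b + k′ ×
               MinUnsat (suc k′) (ldeg M S v (not b)) M (S ∖ Lit M v b) (T ∖ ⁅ v ⁆)
  splitAtMin b = split F sat v∈T b refl (1≤ldeg (not b))
    (≤-reflexive (trans (+-comm (ldeg M S v (not b)) _) (ldeg-sum b)))

  ldeg≤k : ∀ b → ldeg M S v b ≤ k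
  ldeg≤k b = let k′ , eq , _ = splitAtMin b in m+n≤o⇒m≤o _ (≤-reflexive (sym eq))

opaque
  pivot : MinUnsat k m M S T → ∃ (_∈ T) → Pivot k m M S T
  pivot {S = S} F ne with saturateᵈ F
  ... | N , M⊑N , F′ , sat with argmin (deg N S) ne
  ...   | v , v∈T , least = record
    { M⊑M′ = M⊑N ; isSat = sat ; w = v ; w∈T = v∈T ; m≤deg = degrees F′ v∈T
    ; minUnsat = record { mu = mu F′ ; size = size F′ ; degrees = least } }

-- Upper bounds for deficiency at most 5.

Bound : ℕ → ℕ → Set
Bound k b = ∀ {m c n} {M : Matrix c n} {S T} → MinUnsat k m M S T → ∃ (_∈ T) → m ≤ b

opaque
  low-degree : ∀ {k b m} {M : Matrix c n} {S T} → Bound k b → MinUnsat k m M S T → ∃ (_∈ T) →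
               ∃ λ v → v ∈ T × deg M S v ≤ b
  low-degree {M = M} {S} bound F ne with argmin (deg M S) ne
  ... | v , v∈T , least = v , v∈T
    , bound record { mu = mu F ; size = size F ; degrees = least } ne

-- The numerical outcome of splitting at a variable of minimal degree `m`. In `other` the remaining
-- deficiency is `suc k′` and the remaining degrees are at least `e (not b)`; the condition
-- `suc k < m` guarantees a remaining variable, as `Bound` demands.
record Degrees (k m : ℕ) (e : Bool → ℕ) : Set where
  field
    sum   : ∀ b → e b + e (not b) ≡ m
    e≤k   : ∀ b → e b ≤ k
    other : ∀ b → suc k < m → ∃ λ k′ → k ≡ e b + k′ × (∀ {B} → Bound (suc k′) B → e (not b) ≤ B)

degrees-at : MinUnsat k m M S T → Saturated M S T → v ∈ T → deg M S v ≡ m → 1 ≤ m →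
             Degrees k m (ldeg M S v)
degrees-at F sat v∈T deg≡m 1≤m = record
  { sum   = ldeg-sum
  ; e≤k   = ldeg≤k
  ; other = λ b k+1<m → let k′ , eq , F′ = splitAtMin b in
      k′ , eq , λ bound → bound F′ (another-var F v∈T k+1<m) }
  where open LiteralDegrees F sat v∈T deg≡m 1≤m

pivot-degrees : MinUnsat k m M S T → ∃ (_∈ T) → 1 ≤ m →
                ∃₂ λ d e → m ≤ d × Degrees k d e
pivot-degrees F ne 1≤m = _ , _ , m≤deg
  , degrees-at minUnsat isSat w∈T refl (≤-trans 1≤m m≤deg)
  where open Pivot (pivot F ne)

bound₁ : Bound 1 2
bound₁ {zero}  F ne = z≤n
bound₁ {suc m} F ne with pivot-degrees F ne (s≤s z≤n)
... | d , e , m≤d , D = ≤-trans m≤d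
  (≤-trans (≤-reflexive (sym (sum true))) (+-mono-≤ (e≤k true) (e≤k false)))
  where open Degrees D

-- If a literal of the pivot has degree suc k then the other one has degree at
-- most 2; otherwise both have degree at most k.
degrees-bound : ∀ k {m e B} → Degrees (suc k) m e → 3 + k ≤ B → k + k ≤ B → m ≤ B
degrees-bound k {m} {e} {B} D k+3≤B 2k≤B with m ≤? 2 + k
... | yes m≤ = ≤-trans m≤ (<⇒≤ k+3≤B)
... | no  m≰ = result
  where
  open Degrees D
  maximal : ∀ b → e b ≡ suc k → m ≤ B
  maximal b eb≡ with other b (≰⇒> m≰)
  ... | k′ , k≡ , bound with +-cancelˡ-≡ (suc k) k′ 0
    (trans (cong (_+ k′) (sym eb≡)) (trans (sym k≡) (sym (+-identityʳ _))))
  ...   | refl = begin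
    m                ≡⟨ sum b ⟨
    e b + e (not b)  ≤⟨ +-mono-≤ (≤-reflexive eb≡) (bound bound₁) ⟩
    suc k + 2        ≡⟨ +-comm (suc k) 2 ⟩
    3 + k            ≤⟨ k+3≤B ⟩
    B                ∎
    where open ≤-Reasoning
  result : m ≤ B
  result with e true ≟ suc k | e false ≟ suc k
  ... | yes eq | _      = maximal true eq
  ... | no _   | yes eq = maximal false eq
  ... | no ≢₁  | no ≢₀  = ≤-trans (≤-reflexive (sym (sum true))) (≤-trans
    (+-mono-≤ (≤-pred (≤∧≢⇒< (e≤k true) ≢₁)) (≤-pred (≤∧≢⇒< (e≤k false) ≢₀))) 2k≤B)

bound-suc : ∀ k {B} → 3 + k ≤ B → k + k ≤ B → Bound (suc k) B
bound-suc k k+3≤B 2k≤B {zero}  F ne = z≤n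
bound-suc k k+3≤B 2k≤B {suc m} F ne with pivot-degrees F ne (s≤s z≤n)
... | d , e , m≤d , D = ≤-trans m≤d (degrees-bound k D k+3≤B 2k≤B)

bound₂ : Bound 2 4
bound₂ = bound-suc 1 ≤-refl (m≤m+n 2 2)

bound₃ : Bound 3 5
bound₃ = bound-suc 2 ≤-refl (m≤m+n 4 1)

bound₄ : Bound 4 6
bound₄ = bound-suc 3 ≤-refl ≤-refl

bound₅ : Bound 5 8
bound₅ = bound-suc 4 (m≤m+n 7 1) ≤-refl

sum-≤-by-1≤ : ∀ {a b} x → 1 ≤ b → a + b ≤ suc x → a ≤ x
sum-≤-by-1≤ {a} {b} x 1≤b a+b≤ = ≤-pred (≤-trans
  (≤-trans (≤-reflexive (+-comm 1 a)) (+-monoʳ-≤ a 1≤b)) a+b≤)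

-- Deficiency 1: leaves, clashes and unit clauses.

-- By saturation the two clauses containing a variable of degree 2 agree
-- elsewhere, so removing one of them eliminates the variable.
record Leaf (M : Matrix c n) (S : Sub c) (T : Sub n) : Set where
  field
    z       : Fin n
    z∈T     : z ∈ T
    leaf    : Bool → Fin c
    leaf∈S  : ∀ b → leaf b ∈ S
    leaf-z  : ∀ b → M (leaf b) z ≡ just b
    only    : ∀ {i b} → i ∈ S → M i z ≡ just b → i ≡ leaf b
    agree   : ∀ b {j} → j ∈ T → j ≢ z → M (leaf b) j ≡ M (leaf (not b)) j
    rest    : ∀ b → MinUnsat 1 1 M (S ∖ Lit M z b) (T ∖ ⁅ z ⁆)
    deg-z≤2 : deg M S z ≤ 2

  leaf-remains : ∀ b → leaf (not b) ∈ S ∖ Lit M z b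
  leaf-remains b = ∈∖⁺ (leaf∈S (not b)) λ ∈L →
    Bool.not-¬ refl (just-injective (trans (sym (∈Lit⁻ ∈L)) (leaf-z (not b))))

module _ {M : Matrix c n} {S : Sub c} {T : Sub n}
         (F : MinUnsat 1 1 M S T) (sat : Saturated M S T) where

  find-leaf : ∃ (_∈ T) → Leaf M S T
  find-leaf ne with low-degree bound₁ F ne
  ... | z , z∈T , deg≤2 = record
    { z = z ; z∈T = z∈T ; leaf = leaf ; leaf∈S = leaf∈S ; leaf-z = leaf-z
    ; only = only ; agree = agree ; rest = rest ; deg-z≤2 = deg≤2 }
    where
    1≤ldeg = literals-occur (mu F) z∈T (degrees F z∈T)
    ldeg≤1 : ∀ b → ldeg M S z b ≤ 1
    ldeg≤1 b = sum-≤-by-1≤ 1 (1≤ldeg (not b))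
      (≤-trans (≤-reflexive (sym (deg≡ldeg+ldeg M S z b))) deg≤2)
    leaf : Bool → Fin c
    leaf b = proj₁ (cnt-∃ (1≤ldeg b))
    leaf∈S : ∀ b → leaf b ∈ S
    leaf∈S b = proj₁ (∈∩⁻ (proj₂ (cnt-∃ (1≤ldeg b))))
    leaf-z : ∀ b → M (leaf b) z ≡ just b
    leaf-z b = ∈Lit⁻ (proj₂ (∈∩⁻ (proj₂ (cnt-∃ (1≤ldeg b)))))
    only : ∀ {i b} → i ∈ S → M i z ≡ just b → i ≡ leaf b
    only {b = b} i∈S eq = unique (ldeg≤1 b) (∈∩⁺ i∈S (∈Lit⁺ eq)) (proj₂ (cnt-∃ (1≤ldeg b)))

    -- Otherwise some φ with φ j = β satisfies all clauses but leaf b′; so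
    -- φ z ≠ b′, and changing it to b′ satisfies everything.
    agree-on : ∀ b b′ {j β} → b ≡ not b′ → j ∈ T → j ≢ z →
               M (leaf b) j ≡ just β → M (leaf b′) j ≡ just β
    agree-on b b′ {j} {β} b≡ j∈T j≢z eq with Maybe-≡-dec Bool._≟_ (M (leaf b′) j) (just β)
    ... | yes eq′ = eq′
    ... | no ≢β with blocked sat (leaf∈S b′) j∈T ≢β
    ...   | φ , others , φj≡β with unsat (mu F) (φ [ z ]≔ b′)
    ...     | k , k∈S , ¬sat with k Fin.≟ leaf b′
    ...       | yes refl = contradiction
      (via z z∈T (trans (leaf-z b′) (cong just (sym (lookup∘update z φ b′))))) ¬sat
    ...       | no k≢ with others k k∈S k≢
    ...         | via l l∈T holds with l Fin.≟ z
    ...           | no l≢z = contradiction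
      (via l l∈T (trans holds (cong just (sym (lookup-flip φ l≢z))))) ¬sat
    ...           | yes refl = contradiction
      (via j j∈T (trans (cong (λ i → M i j) k≡leaf)
        (trans eq (cong just (trans (sym φj≡β) (sym (lookup-flip φ j≢z))))))) ¬sat
      where
      φz≡b : lookup φ l ≡ b
      φz≡b = trans (Bool.¬-not λ φz≡b′ → MU.allBut-fails (mu F) others
        (via l l∈T (trans (leaf-z b′) (cong just (sym φz≡b′))))) (sym b≡)
      k≡leaf : k ≡ leaf b
      k≡leaf = only k∈S (trans holds (cong just φz≡b))

    agree : ∀ b {j} → j ∈ T → j ≢ z → M (leaf b) j ≡ M (leaf (not b)) j
    agree b {j} j∈T j≢z with M (leaf b) j in eq | M (leaf (not b)) j in eq′
    ... | just β | _ = trans (sym (agree-on b (not b) (sym (Bool.not-involutive b)) j∈T j≢z eq)) eq′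
    ... | nothing | nothing = refl
    ... | nothing | just β = trans (sym eq) (agree-on (not b) b refl j∈T j≢z eq′)

    rest : ∀ b → MinUnsat 1 1 M (S ∖ Lit M z b) (T ∖ ⁅ z ⁆)
    rest b with splitAt F sat z∈T b (≤-antisym (ldeg≤1 b) (1≤ldeg b)) ≤-refl remaining
      where
      -- A variable of the removed leaf also occurs in the other leaf, so no variable other than `z`
      -- vanishes.
      remaining : ∀ {j} → j ∈ T ∖ ⁅ z ⁆ → 1 ≤ deg M (S ∖ Lit M z b) j
      remaining {j} j∈ with ∈-remove⁻ j∈
      ... | j∈T , j≢z with cnt-∃ (degrees F j∈T)
      ...   | i , h with ∈∩⁻ h
      ...     | i∈S , ∈O with i ∈? Lit M z b
      ...       | no ∉L = cnt-pos (∈∩⁺ (∈∖⁺ i∈S ∉L) ∈O)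
      ...       | yes ∈L with ∈Occ⁻ ∈O | only i∈S (∈Lit⁻ ∈L)
      ...         | β , eq | refl = cnt-pos {i = leaf (not b)} (∈∩⁺
        (∈∖⁺ (leaf∈S (not b)) λ ∈L′ →
          Bool.not-¬ refl (just-injective (trans (sym (∈Lit⁻ ∈L′)) (leaf-z (not b)))))
        (∈Occ⁺ (trans (sym (agree b j∈T j≢z)) eq)))
    ... | zero , refl , F′ = F′

module _ {M : Matrix c n} {S : Sub c} {T : Sub n} (ℓ : Leaf M S T) where
  open Leaf ℓ

  -- Sends the removed leaf to its surviving twin, which has the same literals off `z`.
  fold-leaf : Fin c → Fin c
  fold-leaf i with i ∈? Lit M z true
  ... | yes _ = leaf false
  ... | no  _ = i

  fold-leaf∈ : ∀ {i} → i ∈ S → fold-leaf i ∈ S ∖ Lit M z true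
  fold-leaf∈ {i} i∈S with i ∈? Lit M z true
  ... | yes _  = leaf-remains true
  ... | no ∉L = ∈∖⁺ i∈S ∉L

  fold-leaf-agrees : ∀ {i j} → i ∈ S → j ∈ T → j ≢ z → M (fold-leaf i) j ≡ M i j
  fold-leaf-agrees {i} i∈S j∈T j≢z with i ∈? Lit M z true
  ... | no _ = refl
  ... | yes ∈L with only i∈S (∈Lit⁻ ∈L)
  ...   | refl = sym (agree true j∈T j≢z)

  leaves-clash-once : ∀ {i k b j b′} → i ∈ S → k ∈ S → M i z ≡ just b → M k z ≡ just (not b) →
                      j ∈ T → M i j ≡ just b′ → M k j ≡ just (not b′) → j ≡ z
  leaves-clash-once {b = b} {j} i∈S k∈S iz kz j∈T ij kj with j Fin.≟ z
  ... | yes eq = eq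
  ... | no j≢z with only i∈S iz | only k∈S kz
  ...   | refl | refl = contradiction
    (just-injective (trans (sym ij) (trans (agree b j∈T j≢z) kj))) (Bool.not-¬ refl)

-- Induction by eliminating a variable `z` of degree at most 2. Two clauses clashing in `z` are its
-- two leaves, which agree elsewhere; clashes off `z` are passed on by `fold-leaf` to the smaller
-- clause-set.
clash-unique : ∀ {c n} {M : Matrix c n} {S T} → MinUnsat 1 1 M S T →
               ∀ {i k u u′ b b′} → i ∈ S → k ∈ S → u ∈ T → u′ ∈ T →
               M i u ≡ just b → M k u ≡ just (not b) →
               M i u′ ≡ just b′ → M k u′ ≡ just (not b′) → u ≡ u′
clash-unique F = rec _ refl F
  where
  rec : ∀ t {c n} {M : Matrix c n} {S T} → cnt T ≡ t → MinUnsat 1 1 M S T →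
        ∀ {i k u u′ b b′} → i ∈ S → k ∈ S → u ∈ T → u′ ∈ T →
        M i u ≡ just b → M k u ≡ just (not b) →
        M i u′ ≡ just b′ → M k u′ ≡ just (not b′) → u ≡ u′
  rec zero t≡ F i∈S k∈S u∈T u′∈T iu ku iu′ ku′ =
    contradiction (subst (1 ≤_) t≡ (cnt-pos u∈T)) λ ()
  rec (suc t) t≡ F {i} {k} {u} {u′} i∈S k∈S u∈T u′∈T iu ku iu′ ku′ with saturateᵈ F
  ... | N , M⊑N , F′ , sat = go (find-leaf F′ sat (u , u∈T))
    where
    iuᴺ = literal M⊑N iu
    kuᴺ = literal M⊑N ku
    iu′ᴺ = literal M⊑N iu′
    ku′ᴺ = literal M⊑N ku′
    go : Leaf N _ _ → u ≡ u′
    go ℓ with u Fin.≟ Leaf.z ℓ | u′ Fin.≟ Leaf.z ℓ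
    ... | yes refl | _ = sym (leaves-clash-once ℓ i∈S k∈S iuᴺ kuᴺ u′∈T iu′ᴺ ku′ᴺ)
    ... | no _ | yes refl = leaves-clash-once ℓ i∈S k∈S iu′ᴺ ku′ᴺ u∈T iuᴺ kuᴺ
    ... | no u≢z | no u′≢z = rec t
      (suc-injective (trans (sym (cnt-remove (Leaf.z∈T ℓ))) t≡)) (Leaf.rest ℓ true)
      (fold-leaf∈ ℓ i∈S) (fold-leaf∈ ℓ k∈S) (∈-remove⁺ u∈T u≢z) (∈-remove⁺ u′∈T u′≢z)
      (trans (fold-leaf-agrees ℓ i∈S u∈T u≢z) iuᴺ) (trans (fold-leaf-agrees ℓ k∈S u∈T u≢z) kuᴺ)
      (trans (fold-leaf-agrees ℓ i∈S u′∈T u′≢z) iu′ᴺ) (trans (fold-leaf-agrees ℓ k∈S u′∈T u′≢z) ku′ᴺ)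

-- The empty clause counts as a unit clause here.
Unit : Matrix c n → Sub n → Fin c → Fin n → Set
Unit M T i x = ∀ j → j ∈ T → j ≢ x → M i j ≡ nothing

LeafOrUnitAwayFrom : Matrix c n → Sub c → Sub n → Fin c → Set
LeafOrUnitAwayFrom M S T κ =
  (∃ λ u → u ∈ T × deg M S u ≤ 2 × M κ u ≡ nothing) ⊎
  (∃₂ λ i x → i ∈ S × i ≢ κ × x ∈ T × Unit M T i x)

opaque
  -- If `κ` contains the leaf variable `z`, it is one of the two leaves; it is removed and the other
  -- leaf takes its place in the recursion. As the leaves agree off `z`, a variable missing from
  -- that one is missing from `κ` and keeps its degree. A unit clause of the rest other than that
  -- leaf does not contain `z`, so it was a unit clause before. If `z` is the only variable, the
  -- other leaf is a unit clause.
  leaf-or-unit : ∀ {c n} {M : Matrix c n} {S T} → MinUnsat 1 1 M S T → ∃ (_∈ T) →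
                 ∀ {κ} → κ ∈ S → LeafOrUnitAwayFrom M S T κ
  leaf-or-unit F ne = rec _ refl F ne
    where
    rec : ∀ t {c n} {M : Matrix c n} {S T} → cnt T ≡ t → MinUnsat 1 1 M S T → ∃ (_∈ T) →
          ∀ {κ} → κ ∈ S → LeafOrUnitAwayFrom M S T κ
    rec zero t≡ F ne κ∈S = contradiction (subst (1 ≤_) t≡ (cnt-pos (proj₂ ne))) λ ()
    rec (suc t) {M = M} {S} {T} t≡ F ne {κ} κ∈S with saturateᵈ F
    ... | N , M⊑N , F′ , sat = go (find-leaf F′ sat ne)
      where
      go : Leaf N S T → LeafOrUnitAwayFrom M S T κ
      go ℓ with N κ (Leaf.z ℓ) in κz
      ... | nothing = inj₁ (z , z∈T , ≤-trans (deg-mono-⊑ M⊑N) deg-z≤2 , ⊑-nothing M⊑N κz)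
        where open Leaf ℓ
      ... | just s = far (1 ≤? cnt (T ∖ ⁅ z ⁆))
        where
        open Leaf ℓ
        κ≡leaf : κ ≡ leaf s
        κ≡leaf = only κ∈S κz
        leaf≢κ : leaf (not s) ≢ κ
        leaf≢κ eq = Bool.not-¬ refl (just-injective
          (trans (sym κz) (trans (cong (λ i → N i z) (sym eq)) (leaf-z (not s)))))
        far : Dec (1 ≤ cnt (T ∖ ⁅ z ⁆)) → LeafOrUnitAwayFrom M S T κ
        far (no none) = inj₂ (leaf (not s) , z , leaf∈S _ , leaf≢κ , z∈T
          , λ j j∈T j≢z → contradiction (cnt-pos (∈-remove⁺ j∈T j≢z)) none)
        far (yes more) with rec t (suc-injective (trans (sym (cnt-remove z∈T)) t≡))
                                (rest s) (cnt-∃ more) (leaf-remains s)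
        ... | inj₁ (u , u∈ , deg≤2 , leaf-u) = inj₁ (u , u∈T , (begin
            deg M S u                                                  ≤⟨ deg-mono-⊑ M⊑N ⟩
            deg N S u ≡⟨ cnt-∩-partition S (Occ N u) (Lit N z s) ⟩
            deg N (S ∖ Lit N z s) u + cnt (S ∩ Lit N z s ∩ Occ N u)
              ≡⟨ cong (deg N (S ∖ Lit N z s) u +_) (cnt-empty removed) ⟩
            deg N (S ∖ Lit N z s) u + 0                                ≡⟨ +-identityʳ _ ⟩
            deg N (S ∖ Lit N z s) u                                    ≤⟨ deg≤2 ⟩
            2                                                          ∎)
          , ⊑-nothing M⊑N κu)
          where
          open ≤-Reasoning
          u∈T : u ∈ T
          u∈T = proj₁ (∈-remove⁻ u∈)
          κu : N κ u ≡ nothing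
          κu = trans (cong (λ i → N i u) κ≡leaf)
            (trans (agree s u∈T (proj₂ (∈-remove⁻ u∈))) leaf-u)
          removed : ∀ i → i ∉ S ∩ Lit N z s ∩ Occ N u
          removed i h with ∈∩⁻ h
          ... | h′ , ∈O with ∈∩⁻ h′ | ∈Occ⁻ ∈O
          ...   | i∈S , ∈L | β , eq = contradiction (trans (sym eq)
            (trans (cong (λ i → N i u) (trans (only i∈S (∈Lit⁻ ∈L)) (sym κ≡leaf))) κu)) λ ()
        ... | inj₂ (i , x , i∈ , i≢leaf , x∈ , unit) =
          inj₂ (i , x , i∈S , i≢κ , proj₁ (∈-remove⁻ x∈) , λ j j∈T j≢x → ⊑-nothing M⊑N (unit′ j j∈T j≢x))
          where
          i∈S : i ∈ S
          i∈S = proj₁ (∈∖⁻ i∈)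
          i∉L : i ∉ Lit N z s
          i∉L = proj₂ (∈∖⁻ i∈)
          i≢κ : i ≢ κ
          i≢κ refl = i∉L (∈Lit⁺ κz)
          unit′ : Unit N T i x
          unit′ j j∈T j≢x with j Fin.≟ z
          ... | no j≢z = unit j (∈-remove⁺ j∈T j≢z) j≢x
          ... | yes refl with N i j in eq
          ...   | nothing = refl
          ...   | just b with b Bool.≟ s
          ...     | yes refl = contradiction (∈Lit⁺ eq) i∉L
          ...     | no b≢s = contradiction
            (only i∈S (trans eq (cong just (Bool.¬-not b≢s)))) i≢leaf

-- Literal degrees, unit clauses and common variables.

private variable
  e : Bool → ℕ

module _ {m e} (D : Degrees 6 m e) (9≤m : 9 ≤ m) where
  open Degrees D

  private
    9≤sum : ∀ {b x y} → e b ≤ x → e (not b) ≤ y → 9 ≤ x + y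
    9≤sum {b} p q = ≤-trans 9≤m (≤-trans (≤-reflexive (sym (sum b))) (+-mono-≤ p q))

    five : ∀ b {x} → e b ≡ x → 5 ≤ x → x ≤ 6 → e b ≡ 5 × e (not b) ≡ 4
    five b {5} eb≡5 _ _ with other b (≤-trans (n≤1+n 8) 9≤m)
    ... | k′ , 6≡ , bound with trans 6≡ (cong (_+ k′) eb≡5)
    ...   | refl = eb≡5 , ≤-antisym (bound bound₂)
      (+-cancelˡ-≤ 5 4 _ (9≤sum {b} (≤-reflexive eb≡5) ≤-refl))
    five b {6} eb≡6 _ _ with other b (≤-trans (n≤1+n 8) 9≤m)
    ... | k′ , 6≡ , bound with trans 6≡ (cong (_+ k′) eb≡6)
    ...   | refl = contradiction (9≤sum {b} (≤-reflexive eb≡6) (bound bound₁)) (<⇒≱ ≤-refl)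
    five b {suc (suc (suc (suc (suc (suc (suc _))))))} _ _ (s≤s (s≤s (s≤s (s≤s (s≤s (s≤s ()))))))
    five b {0} _ () _
    five b {1} _ (s≤s ()) _
    five b {2} _ (s≤s (s≤s ())) _
    five b {3} _ (s≤s (s≤s (s≤s ()))) _
    five b {4} _ (s≤s (s≤s (s≤s (s≤s ())))) _

  -- Some literal degree is 5 or 6. Degree 6 leaves deficiency 1, so the other literal has degree at
  -- most 2 and the sum is at most 8; degree 5 leaves deficiency 2, so the other has degree at most
  -- 4.
  five-four : ∃ λ b → e b ≡ 5 × e (not b) ≡ 4
  five-four with 5 ≤? e true | 5 ≤? e false
  ... | yes 5≤ | _      = true , five true refl 5≤ (e≤k true)
  ... | no _   | yes 5≤ = false , five false refl 5≤ (e≤k false)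
  ... | no ≱₁  | no ≱₀  = contradiction
    (9≤sum {true} (≤-pred (≰⇒> ≱₁)) (≤-pred (≰⇒> ≱₀))) (<⇒≱ ≤-refl)

three-two : Degrees 3 5 e → ∃ λ b → e b ≡ 3
three-two {e} D with e true ≟ 3 | e false ≟ 3
... | yes eq | _      = true , eq
... | no _   | yes eq = false , eq
... | no ≢₁  | no ≢₀  = contradiction (≤-trans (≤-reflexive (sym (sum true)))
  (+-mono-≤ (≤-pred (≤∧≢⇒< (e≤k true) ≢₁)) (≤-pred (≤∧≢⇒< (e≤k false) ≢₀)))) (<⇒≱ ≤-refl)
  where open Degrees D

two-two : Degrees 2 4 e → ∀ b → e b ≡ 2
two-two D b = ≤-antisym (e≤k b) (+-cancelʳ-≤ 2 2 _
  (≤-trans (≤-reflexive (sym (sum b))) (+-monoʳ-≤ _ (e≤k (not b)))))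
  where open Degrees D

module _ {M : Matrix c n} {S : Sub c} {T : Sub n} where

  -- By saturation all other clauses contain the complement of the unit literal,
  -- so that making it true removes only the unit clause.
  remove-unit : MinUnsat (suc k) m M S T → Saturated M S T → 1 ≤ m →
                ∀ {i x} → i ∈ S → x ∈ T → Unit M T i x →
                ∃ λ b → MinUnsat (suc k) m M (S ∖ Lit M x b) (T ∖ ⁅ x ⁆)
  remove-unit {k = k} {m} F sat 1≤m {i} {x} i∈S x∈T unit = go (M i x) refl
    where
    go : ∀ entry → M i x ≡ entry →
         ∃ λ b → MinUnsat (suc k) m M (S ∖ Lit M x b) (T ∖ ⁅ x ⁆)
    -- The empty clause is excluded: it would have to be satisfied once another clause `κ`,
    -- containing `x`, is left out.
    go nothing ix with cnt-∃ (≤-trans 1≤m (degrees F x∈T))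
    ... | κ , h with ∈∩⁻ h
    ...   | κ∈S , ∈O with ∈Occ⁻ ∈O | MU.critical (mu F) κ∈S
    ... | β , κx | φ , others
      with others i i∈S (λ { refl → contradiction (trans (sym ix) κx) λ () })
    ...       | via j j∈T holds with j Fin.≟ x
    ...         | yes refl = contradiction (trans (sym ix) holds) λ ()
    ...         | no j≢x   = contradiction (trans (sym (unit j j∈T j≢x)) holds) λ ()
    go (just b) ix with splitAt F sat x∈T b ldeg≡1 1≤m remaining
      where
      -- If `κ` is not `i`, saturation with the opposite literal gives an assignment that falsifies
      -- the literal of `i` and yet satisfies all clauses but `κ`.
      only-i : ∀ {κ} → κ ∈ S ∩ Lit M x b → κ ≡ i
      only-i {κ} h with ∈∩⁻ h | κ Fin.≟ i
      ... | _         | yes eq = eq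
      ... | κ∈S , ∈L  | no κ≢i with blocked sat κ∈S x∈T (λ κx → Bool.not-¬ {b} refl
        (just-injective (trans (sym (∈Lit⁻ ∈L)) κx)))
      ...   | φ , others , φx≡ with others i i∈S (κ≢i ∘ sym)
      ...     | via j j∈T holds with j Fin.≟ x
      ...       | yes refl = contradiction
        (trans (just-injective (trans (sym ix) holds)) φx≡) (Bool.not-¬ refl)
      ...       | no j≢x = contradiction (trans (sym (unit j j∈T j≢x)) holds) λ ()
      ldeg≡1 : ldeg M S x b ≡ 1
      ldeg≡1 = trans (cnt-cong
        (λ h → subst (_∈ ⁅ i ⁆) (sym (only-i h)) (∈⁅⁆⁺ i))
        (λ h → subst (_∈ S ∩ Lit M x b) (sym (∈⁅⁆⁻ h)) (∈∩⁺ i∈S (∈Lit⁺ ix)))) (cnt-⁅⁆ i)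
      remaining : ∀ {j} → j ∈ T ∖ ⁅ x ⁆ → m ≤ deg M (S ∖ Lit M x b) j
      remaining {j} j∈ with ∈-remove⁻ j∈
      ... | j∈T , j≢x = begin
        m                                                          ≤⟨ degrees F j∈T ⟩
        deg M S j ≡⟨ cnt-∩-partition S (Occ M j) (Lit M x b) ⟩
        deg M (S ∖ Lit M x b) j + cnt (S ∩ Lit M x b ∩ Occ M j)
          ≡⟨ cong (deg M (S ∖ Lit M x b) j +_) (cnt-empty removed) ⟩
        deg M (S ∖ Lit M x b) j + 0                                ≡⟨ +-identityʳ _ ⟩
        deg M (S ∖ Lit M x b) j                                    ∎
        where
        open ≤-Reasoning
        removed : ∀ κ → κ ∉ S ∩ Lit M x b ∩ Occ M j
        removed κ h with ∈∩⁻ h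
        ... | h′ , ∈O with only-i h′ | ∈Occ⁻ ∈O
        ...   | refl | β , κj = contradiction (trans (sym (unit j j∈T j≢x)) κj) λ ()
    ... | _ , refl , F′ = b , F′

record CommonVariables (M : Matrix c n) (S : Sub c) (T : Sub n) (v : Fin n) (b : Bool) : Set where
  field
    y y′      : Fin n
    y≢y′      : y ≢ y′
    y∈T       : y ∈ T ∖ ⁅ v ⁆
    y′∈T      : y′ ∈ T ∖ ⁅ v ⁆
    y-common  : S ∩ Lit M v b ⊆ Occ M y
    y′-common : S ∩ Lit M v b ⊆ Occ M y′

module _ {M : Matrix c n} {S : Sub c} {T : Sub n} (F : MinUnsat 6 9 M S T) (sat : Saturated M S T)
         {v} (v∈T : v ∈ T) where

  private
    occurs-in-all : ∀ {b} → ldeg M S v b ≡ 4 → ∀ {y} → y ∈ T →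
                    deg M (S ∖ Lit M v b) y ≤ 5 → S ∩ Lit M v b ⊆ Occ M y
    occurs-in-all ldeg≡4 y∈T deg≤5 = deg-drop-all (≤-trans
      (+-mono-≤ deg≤5 (≤-reflexive ldeg≡4)) (degrees F y∈T))

  -- Setting the literal of degree 4 to true yields deficiency 3 and degrees at
  -- least 5, so a variable y of degree 5 and literal degrees 3 and 2; setting
  -- its literal of degree 3 to true yields deficiency 1, so a variable y′ of
  -- degree at most 2, which has lost at most 3 occurrences.
  two-common-variables : ∀ {b} → ldeg M S v b ≡ 4 → CommonVariables M S T v b
  two-common-variables {b} ldeg≡4 with split F sat v∈T b ldeg≡4 (s≤s z≤n) ≤-refl
  ... | _ , refl , H = go (pivot H (another-var F v∈T (n≤1+n 8)))
    where
    go : Pivot 3 5 M (S ∖ Lit M v b) (T ∖ ⁅ v ⁆) → CommonVariables M S T v b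
    go P = record
      { y = w ; y′ = y′ ; y≢y′ = w≢y′ ∘ sym ; y∈T = w∈T ; y′∈T = y′∈T₁
      ; y-common = occurs-in-all ldeg≡4 (proj₁ (∈-remove⁻ w∈T))
          (≤-trans (deg-mono-⊑ M⊑M′) (≤-reflexive deg≡5))
      ; y′-common = occurs-in-all ldeg≡4 (proj₁ (∈-remove⁻ y′∈T₁)) (≤-trans (deg-mono-⊑ M⊑M′)
          (≤-trans (deg-drop M′ _ (Lit M′ w β) y′) (+-mono-≤ deg-y′≤2 (≤-reflexive ldeg≡3)))) }
      where
      open Pivot P
      deg≡5 = ≤-antisym (bound₃ minUnsat (w , w∈T)) m≤deg
      H′ : MinUnsat 3 5 M′ (S ∖ Lit M v b) (T ∖ ⁅ v ⁆)
      H′ = weaken m≤deg minUnsat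
      three = three-two (degrees-at H′ isSat w∈T deg≡5 (s≤s z≤n))
      β = proj₁ three
      ldeg≡3 = proj₂ three
      low : ∃ λ y′ → y′ ∈ T ∖ ⁅ v ⁆ ∖ ⁅ w ⁆ × deg M′ (S ∖ Lit M v b ∖ Lit M′ w β) y′ ≤ 2
      low with split H′ isSat w∈T β {m′ = 2} ldeg≡3 (s≤s z≤n) ≤-refl
      ... | _ , refl , K = low-degree bound₁ K (another-var H′ w∈T ≤-refl)
      y′ = proj₁ low
      deg-y′≤2 = proj₂ (proj₂ low)
      y′∈T₁ = proj₁ (∈-remove⁻ (proj₁ (proj₂ low)))
      w≢y′ = proj₂ (∈-remove⁻ (proj₁ (proj₂ low)))

nothing≢occ : {M : Matrix c n} {i : Fin c} {j : Fin n} → M i j ≡ nothing → i ∉ Occ M j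
nothing≢occ eq ∈O = contradiction (trans (sym eq) (proj₂ (∈Occ⁻ ∈O))) λ ()

unit-occ : ∀ {M : Matrix c n} {T i x j} → Unit M T i x → j ∈ T → i ∈ Occ M j → j ≡ x
unit-occ {M = M} {x = x} {j} unit j∈T ∈O with j Fin.≟ x
... | yes eq = eq
... | no j≢x = contradiction ∈O (nothing≢occ {M = M} (unit j j∈T j≢x))

unit-value : ∀ {M : Matrix c n} {T i x φ b} → Unit M T i x → M i x ≡ just b →
             Satisfies M T i φ → lookup φ x ≡ b
unit-value {M = M} unit ix (via j j∈T holds) with unit-occ {M = M} unit j∈T (∈Occ⁺ holds)
... | refl = sym (just-injective (trans (sym ix) holds))

⊑-Occ : M ⊑ N → Occ M v ⊆ Occ N v
⊑-Occ M⊑N ∈O = ∈Occ⁺ (literal M⊑N (proj₂ (∈Occ⁻ ∈O)))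

-- Deficiency 2 and minimal degree 4.

module Branches {M : Matrix c n} {S : Sub c} {T : Sub n} (F : MinUnsat 2 4 M S T)
                (sat : Saturated M S T) where

  ldeg≡2 : ∀ {u} → u ∈ T → deg M S u ≤ 4 → ∀ b → ldeg M S u b ≡ 2
  ldeg≡2 u∈T deg≤4 =
    two-two (degrees-at F sat u∈T (≤-antisym deg≤4 (degrees F u∈T)) (s≤s z≤n))

  module _ {w} (w∈T : w ∈ T) (deg≤4 : deg M S w ≤ 4) where

    opaque
      branch : ∀ b → MinUnsat 1 2 M (S ∖ Lit M w b) (T ∖ ⁅ w ⁆)
      branch b with split F sat w∈T b (ldeg≡2 w∈T deg≤4 b) (s≤s z≤n) ≤-refl
      ... | _ , refl , F′ = F′

      branch-var : ∃ (_∈ T ∖ ⁅ w ⁆)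
      branch-var = another-var F w∈T ≤-refl

    module _ {b u} (u∈ : u ∈ T ∖ ⁅ w ⁆) (low : deg M (S ∖ Lit M w b) u ≤ 2) where

      low⇒deg≤4 : deg M S u ≤ 4
      low⇒deg≤4 = ≤-trans (deg-drop M S (Lit M w b) u)
        (+-mono-≤ low (≤-reflexive (ldeg≡2 w∈T deg≤4 b)))

      low⇒occurs : S ∩ Lit M w b ⊆ Occ M u
      low⇒occurs = deg-drop-all (≤-trans
        (+-mono-≤ low (≤-reflexive (ldeg≡2 w∈T deg≤4 b))) (degrees F (proj₁ (∈-remove⁻ u∈))))

      opaque
        -- Each literal of `u` has degree 2. At most one of these occurrences remains in the branch,
        -- where both literals of `u` occur and its degree is at most 2.
        removed-occurrence : ∀ β → ∃ λ i → i ∈ S ∩ Lit M w b × M i u ≡ just β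
        removed-occurrence β with cnt-∃ {p = S ∩ Lit M w b ∩ Lit M u β} (+-cancelˡ-≤ 1 _ _ (begin
          2 ≡⟨ ldeg≡2 (proj₁ (∈-remove⁻ u∈)) low⇒deg≤4 β ⟨
          ldeg M S u β ≡⟨ cnt-∩-partition S (Lit M u β) (Lit M w b) ⟩
          ldeg M (S ∖ Lit M w b) u β + cnt (S ∩ Lit M w b ∩ Lit M u β) ≤⟨ +-monoˡ-≤ _ ldeg≤1 ⟩
          1 + cnt (S ∩ Lit M w b ∩ Lit M u β)                                 ∎))
          where
          open ≤-Reasoning
          F′ : MinUnsat 1 2 M (S ∖ Lit M w b) (T ∖ ⁅ w ⁆)
          F′ = branch b
          ldeg≤1 : ldeg M (S ∖ Lit M w b) u β ≤ 1
          ldeg≤1 = sum-≤-by-1≤ 1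
            (literals-occur (mu F′) u∈ (≤-trans (s≤s z≤n) (degrees F′ u∈)) (not β))
            (≤-trans (≤-reflexive (sym (deg≡ldeg+ldeg M (S ∖ Lit M w b) u β))) low)
        ... | i , h = i , proj₁ (∈∩⁻ h) , ∈Lit⁻ (proj₂ (∈∩⁻ h))

    -- Both variables clash between the two clauses removed in the branch, which
    -- survive in the opposite branch, where any two clauses clash at most once.
    opaque
      low-unique : ∀ {b u u′} → u ∈ T ∖ ⁅ w ⁆ → deg M (S ∖ Lit M w b) u ≤ 2 →
                   u′ ∈ T ∖ ⁅ w ⁆ → deg M (S ∖ Lit M w b) u′ ≤ 2 → u ≡ u′
      low-unique {b} {u} {u′} u∈ low u′∈ low′ = go (proj₁ (O′ true) Fin.≟ proj₁ (O true))
        where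
        O : ∀ β → ∃ λ i → i ∈ S ∩ Lit M w b × M i u ≡ just β
        O = removed-occurrence u∈ low
        O′ : ∀ β → ∃ λ i → i ∈ S ∩ Lit M w b × M i u′ ≡ just β
        O′ = removed-occurrence u′∈ low′
        O∈ : ∀ β → proj₁ (O β) ∈ S ∩ Lit M w b
        O∈ β = proj₁ (proj₂ (O β))
        O′∈ : ∀ β → proj₁ (O′ β) ∈ S ∩ Lit M w b
        O′∈ β = proj₁ (proj₂ (O′ β))
        value : ∀ β → M (proj₁ (O β)) u ≡ just β
        value β = proj₂ (proj₂ (O β))
        value′ : ∀ β → M (proj₁ (O′ β)) u′ ≡ just β
        value′ β = proj₂ (proj₂ (O′ β))
        survives : ∀ {i} → i ∈ S ∩ Lit M w b → i ∈ S ∖ Lit M w (not b)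
        survives h = let i∈S , ∈L = ∈∩⁻ h in
          ∈∖⁺ i∈S λ ∈L′ → Bool.not-¬ {b} refl
            (just-injective (trans (sym (∈Lit⁻ ∈L)) (∈Lit⁻ ∈L′)))
        distinct-values : ∀ {i k j} → M i j ≡ just true → M k j ≡ just false → i ≢ k
        distinct-values it kf refl = contradiction (trans (sym it) kf) λ ()
        Ot≢Of : proj₁ (O true) ≢ proj₁ (O false)
        Ot≢Of = distinct-values (value true) (value false)
        O′t≢O′f : proj₁ (O′ true) ≢ proj₁ (O′ false)
        O′t≢O′f = distinct-values (value′ true) (value′ false)
        ≤2 : ldeg M S w b ≤ 2
        ≤2 = ≤-reflexive (ldeg≡2 w∈T deg≤4 b)
        clash : ∀ {i k β} → i ≡ proj₁ (O true) → k ≡ proj₁ (O false) →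
                M i u′ ≡ just β → M k u′ ≡ just (not β) → u ≡ u′
        clash refl refl = clash-unique (weaken (s≤s z≤n) (branch (not b)))
          (survives (O∈ true)) (survives (O∈ false)) u∈ u′∈ (value true) (value false)
        -- Exactly two clauses contain this literal of `w`, so `O′ true` and `O′ false` are the
        -- clauses of `O` in one of the two orders.
        go : Dec (proj₁ (O′ true) ≡ proj₁ (O true)) → u ≡ u′
        go (yes same) = clash same
          (pair ≤2 (O∈ true) (O∈ false) Ot≢Of (O′∈ false) λ eq → O′t≢O′f (trans same (sym eq)))
          (value′ true) (value′ false)
        go (no diff) = clash
          (pair ≤2 (O∈ false) (O∈ true) (Ot≢Of ∘ sym) (O′∈ false)
            λ eq → O′t≢O′f (trans swapped (sym eq)))
          swapped (value′ false) (value′ true)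
          where
          swapped : proj₁ (O′ true) ≡ proj₁ (O false)
          swapped = pair ≤2 (O∈ true) (O∈ false) Ot≢Of (O′∈ true) diff

-- Excluding minimal degree 9 in deficiency 6.

not-just : ∀ {m : Maybe Bool} {a} → m ≢ just a → m ≡ nothing ⊎ m ≡ just (not a)
not-just {nothing} ≢a = inj₁ refl
not-just {just b}  ≢a = inj₂ (cong just (Bool.¬-not (≢a ∘ cong just)))

2^t<t+6 : ∀ {t} → t ≤ 3 → 2 ^ t < t + 6
2^t<t+6 {0} _ = m≤m+n 2 4
2^t<t+6 {1} _ = m≤m+n 3 4
2^t<t+6 {2} _ = m≤m+n 5 3
2^t<t+6 {3} _ = ≤-refl
2^t<t+6 {suc (suc (suc (suc _)))} (s≤s (s≤s (s≤s ())))

-- `N` extends `M`, so occurrences pass from `M` to `N` and absences from `N` to `M`. When applied,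
-- `l` is the sign of the literal of `w` of degree 5 in `M`; its complement has degree 4, which
-- yields `common-w`.
module UnitFree
  {M : Matrix c n} {S : Sub c} {T : Sub n} (F : MinUnsat 6 9 M S T)
  (no-unit : ∀ {i x} → i ∈ S → x ∈ T → ¬ Unit M T i x)
  {v} (v∈T : v ∈ T) {a} (ldeg-ā : ldeg M S v (not a) ≡ 4)
  {N} (M⊑N : M ⊑ N) (G : MinUnsat 2 4 N (S ∖ Lit M v a) (T ∖ ⁅ v ⁆))
  (satᴳ : Saturated N (S ∖ Lit M v a) (T ∖ ⁅ v ⁆))
  {w} (w∈ : w ∈ T ∖ ⁅ v ⁆) (deg-w≤4 : deg N (S ∖ Lit M v a) w ≤ 4)
  {l} (common-v : CommonVariables M S T v (not a))
  (common-w : CommonVariables M S T w (not l)) where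

  open Branches G satᴳ

  S₁ = S ∖ Lit M v a
  T₁ = T ∖ ⁅ v ⁆
  S₂ = S₁ ∖ Lit N w l
  T₂ = T₁ ∖ ⁅ w ⁆
  E  = S ∩ Lit M v (not a)

  E⊆S₁ : E ⊆ S₁
  E⊆S₁ h = let i∈S , ∈L = ∈∩⁻ h in ∈∖⁺ i∈S λ ∈L′ →
    Bool.not-¬ {a} refl (just-injective (trans (sym (∈Lit⁻ ∈L′)) (∈Lit⁻ ∈L)))

  E-Occ⇒Lit : ∀ {i} → i ∈ S₂ → i ∈ Occ N w → i ∈ Lit N w (not l)
  E-Occ⇒Lit i∈S₂ ∈O with ∈Occ⁻ ∈O
  ... | β , eq = ∈Lit⁺ (trans eq (cong just (Bool.¬-not
    λ { refl → proj₂ (∈∖⁻ i∈S₂) (∈Lit⁺ eq) })))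

  record UnitShape (i : Fin c) (x : Fin n) : Set where
    field
      i∈E : i ∈ E
      E⊆w : E ⊆ Occ M w
      E⊆x : E ⊆ Occ M x

  w∈T : w ∈ T
  w∈T = proj₁ (∈-remove⁻ w∈)

  -- In `M` the clause `i` has variables only among `v`, `w`, `x`. If it missed `v`, it would be a
  -- unit clause of `M` or contain, besides `w`, both variables of `common-w`, which are distinct.
  -- So it lies in `E`, and the two variables of `common-v` can only be `w` and `x`.
  unit-shape : ∀ {i x} → i ∈ S₂ → x ∈ T₂ → Unit N T₂ i x → UnitShape i x
  unit-shape {i} {x} i∈S₂ x∈T₂ unit = shape (not-just (i∉La ∘ ∈Lit⁺))
    where
    i∈S₁ = proj₁ (∈∖⁻ i∈S₂)
    i∈S = proj₁ (∈∖⁻ i∈S₁)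
    i∉La = proj₂ (∈∖⁻ i∈S₁)
    x∈T = proj₁ (∈-remove⁻ (proj₁ (∈-remove⁻ x∈T₂)))

    vars : ∀ {j} → j ∈ T → i ∈ Occ M j → j ≢ v → j ≢ w → j ≡ x
    vars j∈T ∈O j≢v j≢w = unit-occ {M = N} unit
      (∈-remove⁺ (∈-remove⁺ j∈T j≢v) j≢w) (⊑-Occ M⊑N ∈O)

    module _ (iv : M i v ≡ nothing) where
      vars-w : ∀ {j} → j ∈ T ∖ ⁅ w ⁆ → i ∈ Occ M j → j ≡ x
      vars-w j∈ ∈O = let j∈T , j≢w = ∈-remove⁻ j∈ in
        vars j∈T ∈O (λ { refl → nothing≢occ {M = M} iv ∈O }) j≢w

      impossible : M i w ≡ nothing ⊎ M i w ≡ just (not l) → UnitShape i x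
      impossible (inj₁ iw) = contradiction unitᴹ (no-unit i∈S x∈T)
        where
        unitᴹ : Unit M T i x
        unitᴹ j j∈T j≢x with M i j in eq
        ... | nothing = refl
        ... | just _  = contradiction (vars j∈T (∈Occ⁺ eq)
          (λ { refl → nothing≢occ {M = M} iv (∈Occ⁺ eq) })
          (λ { refl → nothing≢occ {M = M} iw (∈Occ⁺ eq) })) j≢x
      impossible (inj₂ iw) = contradiction
        (trans (vars-w y∈T (y-common i∈λ)) (sym (vars-w y′∈T (y′-common i∈λ)))) y≢y′
        where
        open CommonVariables common-w
        i∈λ = ∈∩⁺ i∈S (∈Lit⁺ iw)

    shape : M i v ≡ nothing ⊎ M i v ≡ just (not a) → UnitShape i x
    shape (inj₁ iv) = impossible iv
      (not-just λ iw → proj₂ (∈∖⁻ i∈S₂) (∈Lit⁺ (literal M⊑N iw)))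
    shape (inj₂ iv) = order (y Fin.≟ w) (y′ Fin.≟ w)
      where
      open CommonVariables common-v
      i∈E = ∈∩⁺ i∈S (∈Lit⁺ iv)
      vars-v : ∀ {j} → j ∈ T₁ → i ∈ Occ M j → j ≢ w → j ≡ x
      vars-v j∈ ∈O j≢w = let j∈T , j≢v = ∈-remove⁻ j∈ in vars j∈T ∈O j≢v j≢w
      order : Dec (y ≡ w) → Dec (y′ ≡ w) → UnitShape i x
      order (yes y≡w)  (yes y′≡w) = contradiction (trans y≡w (sym y′≡w)) y≢y′
      order (yes y≡w)  (no y′≢w)  = record
        { i∈E = i∈E ; E⊆w = subst (λ z → E ⊆ Occ M z) y≡w y-common
        ; E⊆x = subst (λ z → E ⊆ Occ M z) (vars-v y′∈T (y′-common i∈E) y′≢w) y′-common }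
      order (no y≢w)   (yes y′≡w) = record
        { i∈E = i∈E ; E⊆w = subst (λ z → E ⊆ Occ M z) y′≡w y′-common
        ; E⊆x = subst (λ z → E ⊆ Occ M z) (vars-v y∈T (y-common i∈E) y≢w) y-common }
      order (no y≢w)   (no y′≢w)  = contradiction
        (trans (vars-v y∈T (y-common i∈E) y≢w) (sym (vars-v y′∈T (y′-common i∈E) y′≢w))) y≢y′

  F₂ = branch w∈ deg-w≤4 l

  -- By `low-unique` only `z` has degree at most 2 in this branch, and `κ` is chosen to contain `z`;
  -- so `leaf-or-unit` must give a unit clause.
  first-unit : ∃₂ λ i x → i ∈ S₂ × x ∈ T₂ × Unit N T₂ i x
  first-unit with low-degree bound₁ F₂ (branch-var w∈ deg-w≤4)
  ... | z , z∈ , deg-z≤2 with cnt-∃ (≤-trans (s≤s z≤n) (degrees F₂ z∈))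
  ...   | κ , h with ∈∩⁻ h
  ...     | κ∈ , κ-z with leaf-or-unit (weaken (s≤s z≤n) F₂) (z , z∈) κ∈
  ...       | inj₂ (i , x , i∈ , _ , x∈ , unit) = i , x , i∈ , x∈ , unit
  ...       | inj₁ (u , u∈ , deg-u≤2 , κ-u) with low-unique w∈ deg-w≤4 u∈ deg-u≤2 z∈ deg-z≤2
  ...         | refl = contradiction κ-z (nothing≢occ {M = N} κ-u)

  module _ {i x} (i∈ : i ∈ S₂) (x∈ : x ∈ T₂) (unit : Unit N T₂ i x) where
    open UnitShape (unit-shape i∈ x∈ unit)

    -- The opposite branch also has a variable of degree at most 2, and it occurs in all clauses of
    -- `S₁` with sign `not l` on `w`. The clause `i` is one of these, and `x` is its only variable
    -- in `T₂`.
    deg-x≤4 : deg N S₁ x ≤ 4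
    deg-x≤4 with low-degree bound₁ (branch w∈ deg-w≤4 (not l)) (branch-var w∈ deg-w≤4)
    ... | u , u∈ , deg-u≤2 with unit-occ {M = N} unit u∈ (low⇒occurs w∈ deg-w≤4 u∈ deg-u≤2
      (∈∩⁺ (E⊆S₁ i∈E) (E-Occ⇒Lit i∈ (⊑-Occ M⊑N (E⊆w i∈E)))))
    ...   | refl = low⇒deg≤4 w∈ deg-w≤4 u∈ deg-u≤2

    -- The four clauses of `E` use up the degree of `x`.
    x-only-in-E : S₁ ∩ Occ N x ⊆ E
    x-only-in-E = cnt-≥⇒⊇ (λ h → ∈∩⁺ (E⊆S₁ h) (⊑-Occ M⊑N (E⊆x h)))
      (≤-trans deg-x≤4 (≤-reflexive (sym ldeg-ā)))

    deg₂-x≤2 : deg N S₂ x ≤ 2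
    deg₂-x≤2 = ≤-trans
      (cnt-mono λ h → let k∈S₂ , ∈O = ∈∩⁻ h ; k∈S₁ = proj₁ (∈∖⁻ k∈S₂) in
        ∈∩⁺ k∈S₁ (E-Occ⇒Lit k∈S₂ (⊑-Occ M⊑N (E⊆w (x-only-in-E (∈∩⁺ k∈S₁ ∈O))))))
      (≤-reflexive (ldeg≡2 w∈ deg-w≤4 (not l)))

    -- Only `x` has degree at most 2, and it occurs in `i`; so there is a unit clause other than
    -- `i`. Its variable occurs in all clauses of `E`, in particular in `i`, hence it is `x` again.
    second-unit : ∃ λ i′ → i′ ∈ S₂ × i′ ≢ i × Unit N T₂ i′ x × i′ ∈ Occ N x
    second-unit with leaf-or-unit (weaken (s≤s z≤n) F₂) (x , x∈) i∈
    ... | inj₁ (u , u∈ , deg-u≤2 , i-u) with low-unique w∈ deg-w≤4 u∈ deg-u≤2 x∈ deg₂-x≤2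
    ...   | refl = contradiction (⊑-Occ M⊑N (E⊆x i∈E)) (nothing≢occ {M = N} i-u)
    second-unit | inj₂ (i′ , x′ , i′∈ , i′≢i , x′∈ , unit′)
      with unit-shape i′∈ x′∈ unit′
    ... | shape′ with unit-occ {M = N} unit x′∈ (⊑-Occ M⊑N (UnitShape.E⊆x shape′ i∈E))
    ...   | refl = i′ , i′∈ , i′≢i , unit′ , ⊑-Occ M⊑N (UnitShape.E⊆x shape′ (UnitShape.i∈E shape′))

    -- The two unit clauses on `x` have opposite signs, since otherwise one would not be critical.
    -- They are then unsatisfiable by themselves and exclude a third clause.
    only-two : ∃ λ i′ → ∀ {κ} → κ ∈ S₂ → κ ≡ i ⊎ κ ≡ i′
    only-two with second-unit | ∈Occ⁻ (⊑-Occ M⊑N (E⊆x i∈E))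
    ... | i′ , i′∈ , i′≢i , unit′ , ∈O | β , ix with ∈Occ⁻ ∈O
    ...   | β′ , i′x = i′ , λ κ∈ → cover κ∈
      where
      β≢β′ : β ≢ β′
      β≢β′ refl with critical (mu F₂) i′∈
      ... | φ , others = MU.allBut-fails (mu F₂) others (via x x∈ (trans i′x (cong just (sym
        (unit-value {M = N} unit ix (others i i∈ (i′≢i ∘ sym)))))))
      cover : ∀ {κ} → κ ∈ S₂ → κ ≡ i ⊎ κ ≡ i′
      cover {κ} κ∈ with κ Fin.≟ i | κ Fin.≟ i′
      ... | yes eq | _      = inj₁ eq
      ... | no _   | yes eq = inj₂ eq
      ... | no κ≢i | no κ≢i′ with critical (mu F₂) κ∈
      ...   | φ , others = contradiction
        (trans (sym (unit-value {M = N} unit ix (others i i∈ (κ≢i ∘ sym))))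
               (unit-value {M = N} unit′ i′x (others i′ i′∈ (κ≢i′ ∘ sym)))) β≢β′

    cnt-T≤3 : cnt T ≤ 3
    cnt-T≤3 = begin
      cnt T                 ≡⟨ trans (cnt-remove v∈T) (cong suc (cnt-remove w∈)) ⟩
      -- By deficiency 1, `T₂` has one element fewer than `S₂`.
      2 + cnt T₂            ≡⟨ cong suc (trans (+-comm 1 _) (sym (size F₂))) ⟩
      1 + cnt S₂            ≤⟨ s≤s (cnt≤2 i (proj₁ only-two) (proj₂ only-two)) ⟩
      3                     ∎
      where open ≤-Reasoning

  absurd : ⊥
  absurd with first-unit
  ... | i , x , i∈ , x∈ , unit = <⇒≱ (2^t<t+6 (cnt-T≤3 i∈ x∈ unit))
    (≤-trans (≤-reflexive (sym (size F))) (cnt≤2^cnt (mu F)))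

-- Induction on the number of variables: removing a unit clause would give a smaller example, so
-- there is none.
no-6-9 : MinUnsat 6 9 M S T → ∃ (_∈ T) → ⊥
no-6-9 F ne = rec _ refl F ne
  where
  five-four-at : ∀ {c n} {M : Matrix c n} {S T v} → MinUnsat 6 9 M S T → Saturated M S T → v ∈ T →
                 deg M S v ≤ 9 → ∃ λ b → ldeg M S v b ≡ 5 × ldeg M S v (not b) ≡ 4
  five-four-at F sat v∈T deg≤9 = five-four
    (degrees-at F sat v∈T (≤-antisym deg≤9 (degrees F v∈T)) (s≤s z≤n)) ≤-refl

  unit-free : ∀ {c n} {M : Matrix c n} {S T} (F : MinUnsat 6 9 M S T) → Saturated M S T →
              (∀ {i x} → i ∈ S → x ∈ T → ¬ Unit M T i x) →
              ∀ {v} → v ∈ T → deg M S v ≤ 9 → ⊥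
  unit-free {M = M} {S} {T} F sat no-unit {v} v∈T deg≤9 with five-four-at F sat v∈T deg≤9
  ... | a , ldeg-a , ldeg-ā with split F sat v∈T a ldeg-a (s≤s z≤n) ≤-refl
  ...   | _ , refl , G = go (pivot G (another-var F v∈T (n≤1+n 8)))
    where
    go : Pivot 2 4 M (S ∖ Lit M v a) (T ∖ ⁅ v ⁆) → ⊥
    -- Setting the literal of degree 5 to true removes five clauses and leaves `w` with degree at
    -- most 4, so its degree was at most 9.
    go P with five-four-at F sat (proj₁ (∈-remove⁻ (Pivot.w∈T P))) (≤-trans (deg-drop M S (Lit M v a) _)
      (+-mono-≤ (≤-trans (deg-mono-⊑ (Pivot.M⊑M′ P)) (bound₂ (Pivot.minUnsat P) (_ , Pivot.w∈T P)))
                (≤-reflexive ldeg-a)))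
    ... | l , _ , ldeg-λ = UnitFree.absurd F no-unit v∈T ldeg-ā M⊑M′
      (weaken m≤deg minUnsat) isSat w∈T (bound₂ minUnsat (w , w∈T))
      (two-common-variables F sat v∈T ldeg-ā)
      (two-common-variables F sat (proj₁ (∈-remove⁻ w∈T)) ldeg-λ)
      where open Pivot P

  rec : ∀ t {c n} {M : Matrix c n} {S T} → cnt T ≡ t → MinUnsat 6 9 M S T → ∃ (_∈ T) → ⊥
  rec zero    t≡ F ne = contradiction (subst (1 ≤_) t≡ (cnt-pos (proj₂ ne))) λ ()
  rec (suc t) {S = S} {T} t≡ F ne = go (pivot F ne)
    where
    go : Pivot 6 9 _ S T → ⊥
    go P = unit-free F′ isSat no-unit w∈T deg≤9
      where
      open Pivot P
      F′ = weaken m≤deg minUnsat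
      D = degrees-at minUnsat isSat w∈T refl (≤-trans (s≤s z≤n) m≤deg)
      deg≤9 : deg M′ S w ≤ 9
      deg≤9 with five-four D m≤deg
      ... | b , eq , eq′ = ≤-reflexive (trans (sym (Degrees.sum D b)) (cong₂ _+_ eq eq′))
      no-unit : ∀ {i x} → i ∈ S → x ∈ T → ¬ Unit M′ T i x
      no-unit i∈S x∈T unit with remove-unit F′ isSat (s≤s z≤n) i∈S x∈T unit
      ... | b , F″ = rec t (suc-injective (trans (sym (cnt-remove x∈T)) t≡)) F″
        (another-var F′ x∈T (n≤1+n 8))

bound₆ : Bound 6 8
bound₆ {m} F ne with m ≤? 8
... | yes m≤8 = m≤8
... | no  m≰8 = contradiction ne (no-6-9 (weaken (≰⇒> m≰8) F))

-- The recursion for `nM`.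

-- An abstract g in place of N₁ keeps Agda from evaluating N₁.
module NonMersenne (g : ℕ → ℕ)
  (g-rec : ∀ k → 6 < k → ∃ λ m → IsLargest ([_] ∘ g) k m × g k ≡ m)
  (small-< : ∀ k → 1 ≤ k → k ≤ 6 → k < g k)
  (small-bound : ∀ k → 1 ≤ k → k ≤ 6 → Bound k (g k)) where

  +k≤2k : ∀ {x k} → x ≤ k → x + k ≤ 2 * k
  +k≤2k {k = k} x≤k = +-mono-≤ x≤k (≤-reflexive (sym (+-identityʳ k)))

  -- For `k > 6` the pair `(2, k)` satisfies the pdp conditions for `k + 2`: by induction
  -- `g (k - 1) ≥ k`, and `g 1 ≥ 2`. This settles degrees up to `k + 1`; larger ones are treated by
  -- `pdp`.
  k<g : ∀ k → 1 ≤ k → k < g k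
  k<g = <-rec _ step
    where
    step : ∀ k → (∀ {j} → j < k → 1 ≤ j → j < g j) → 1 ≤ k → k < g k
    step k rec 1≤k with k ≤? 6
    ... | yes k≤6 = small-< k 1≤k k≤6
    ... | no  k≰6 with g-rec k (≰⇒> k≰6)
    ...   | m , largest , g≡m = subst (k <_) (sym g≡m) (≤-trans (n≤1+n (suc k))
      (IsLargest.maximal largest (2 + k) 4≤2+k (+k≤2k 2≤k)
        (2 , k , mkPdp ≤-refl 2≤k 2≤k ≤-refl refl 2≤k [ bound ] [ +-monoˡ-≤ k 2≤g ])))
      where
      2≤k : 2 ≤ k
      2≤k = ≤-trans (m≤m+n 2 5) (≰⇒> k≰6)
      4≤2+k : 4 ≤ 2 + k
      4≤2+k = +-monoʳ-≤ 2 2≤k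
      predecessor : suc (k ∸ 2 + 1) ≡ k
      predecessor = trans (sym (+-suc (k ∸ 2) 1)) (m∸n+n≡m 2≤k)
      bound : 2 + k ≤ g (k ∸ 2 + 1) + 2
      bound = ≤-trans (≤-reflexive (+-comm 2 k)) (+-monoˡ-≤ 2
        (subst (_≤ g (k ∸ 2 + 1)) predecessor (rec (≤-reflexive predecessor) (m≤n+m 1 (k ∸ 2)))))
      2≤g : 2 ≤ g (k ∸ k + 1)
      2≤g = subst (λ i → 2 ≤ g (i + 1)) (sym (n∸n≡0 k)) (small-< 1 ≤-refl (m≤m+n 1 5))

  module _ {k d e} (D : Degrees k d e) (k+1<d : suc k < d) where
    open Degrees D

    2≤e : ∀ b → 2 ≤ e b
    2≤e b = +-cancelʳ-≤ k 2 (e b) (≤-trans k+1<d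
      (≤-trans (≤-reflexive (sym (sum b))) (+-monoʳ-≤ (e b) (e≤k (not b)))))

    -- Setting the literal with sign `b` to true leaves deficiency `k + 1 - e b`, below `k` because
    -- of `2≤e`, and degrees at least `e (not b)`, so the induction hypothesis bounds `e (not b)`.
    d≤ : (∀ {j} → j < k → 1 ≤ j → Bound j (g j)) → ∀ b → d ≤ g (k ∸ e b + 1) + e b
    d≤ rec b with other b k+1<d
    ... | k′ , k≡ , bound = ≤-trans (≤-reflexive (trans (sym (sum b)) (+-comm (e b) _)))
      (+-monoˡ-≤ (e b) (subst (λ j → e (not b) ≤ g j) shift (bound (rec suc-k′<k (s≤s z≤n)))))
      where
      shift : suc k′ ≡ k ∸ e b + 1
      shift = trans (+-comm 1 k′) (cong (_+ 1)
        (sym (trans (cong (_∸ e b) k≡) (m+n∸m≡n (e b) k′))))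
      suc-k′<k : suc k′ < k
      suc-k′<k = ≤-trans (+-monoˡ-≤ k′ (2≤e b)) (≤-reflexive (sym k≡))

    pdp : (∀ b → d ≤ g (k ∸ e b + 1) + e b) → pdp≢∅ ([_] ∘ g) k d
    pdp bound with ≤-total (e true) (e false)
    ... | inj₁ t≤f = e true , e false , mkPdp (2≤e true) (2≤e false) (e≤k true) (e≤k false)
      (sum true) t≤f [ bound true ] [ bound false ]
    ... | inj₂ f≤t = e false , e true , mkPdp (2≤e false) (2≤e true) (e≤k false) (e≤k true)
      (sum false) f≤t [ bound false ] [ bound true ]

  bound-g : ∀ k → 1 ≤ k → Bound k (g k)
  bound-g = <-rec (λ k → 1 ≤ k → Bound k (g k)) step
    where
    step : ∀ k → (∀ {j} → j < k → 1 ≤ j → Bound j (g j)) → 1 ≤ k → Bound k (g k)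
    step k rec 1≤k {zero}  F ne = z≤n
    step k rec 1≤k {suc _} F ne with k ≤? 6
    ... | yes k≤6 = small-bound k 1≤k k≤6 F ne
    ... | no  k≰6 with pivot-degrees F ne (s≤s z≤n)
    ...   | d , e , m≤d , D with d ≤? suc k
    ...     | yes d≤1+k = ≤-trans m≤d (≤-trans d≤1+k (k<g k 1≤k))
    ...     | no  d≰1+k with g-rec k (≰⇒> k≰6)
    ...       | _ , largest , g≡ = ≤-trans m≤d (subst (d ≤_) (sym g≡)
      (IsLargest.maximal largest d 4≤d d≤2k (pdp D (≰⇒> d≰1+k) (d≤ D (≰⇒> d≰1+k) rec))))
      where
      open Degrees D
      4≤d : 4 ≤ d
      4≤d = ≤-trans (m≤m+n 4 5) (≤-trans (s≤s (s≤s (≰⇒> k≰6))) (≰⇒> d≰1+k))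
      d≤2k : d ≤ 2 * k
      d≤2k = ≤-trans (≤-reflexive (sym (sum true)))
        (≤-trans (+-monoʳ-≤ (e true) (e≤k false)) (+k≤2k (e≤k true)))

bound-N₁ : ∀ k → 1 ≤ k → Bound k (N₁ k)
bound-N₁ = NonMersenne.bound-g N₁ N₁-largest small-< small-bound
  where
  unbounded : ∀ m k → 6 < k → m ⊓∞ [2,4,5,6,8,8] k ≡ m
  unbounded m (suc (suc (suc (suc (suc (suc (suc _))))))) _ = refl
  unbounded m 6 (s≤s (s≤s (s≤s (s≤s (s≤s (s≤s ()))))))
  unbounded m 5 (s≤s (s≤s (s≤s (s≤s (s≤s ())))))
  unbounded m 4 (s≤s (s≤s (s≤s (s≤s ()))))
  unbounded m 3 (s≤s (s≤s (s≤s ())))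
  unbounded m 2 (s≤s (s≤s ()))
  unbounded m 1 (s≤s ())

  N₁-largest : ∀ k → 6 < k → ∃ λ m → IsLargest ([_] ∘ N₁) k m × N₁ k ≡ m
  N₁-largest k 6<k with N₁-rec k (≤-trans (m≤m+n 2 5) 6<k)
  ... | m , largest , N₁≡ = m , largest , trans N₁≡ (unbounded m k 6<k)

  up-to-6 : ∀ {P : ℕ → Set} → P 1 → P 2 → P 3 → P 4 → P 5 → P 6 → ∀ k → 1 ≤ k → k ≤ 6 → P k
  up-to-6 p₁ p₂ p₃ p₄ p₅ p₆ 1 _ _ = p₁
  up-to-6 p₁ p₂ p₃ p₄ p₅ p₆ 2 _ _ = p₂
  up-to-6 p₁ p₂ p₃ p₄ p₅ p₆ 3 _ _ = p₃
  up-to-6 p₁ p₂ p₃ p₄ p₅ p₆ 4 _ _ = p₄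
  up-to-6 p₁ p₂ p₃ p₄ p₅ p₆ 5 _ _ = p₅
  up-to-6 p₁ p₂ p₃ p₄ p₅ p₆ 6 _ _ = p₆
  up-to-6 p₁ p₂ p₃ p₄ p₅ p₆ (suc (suc (suc (suc (suc (suc (suc _)))))))
    _ (s≤s (s≤s (s≤s (s≤s (s≤s (s≤s ()))))))

  -- By evaluation `N₁` takes the values 2, 4, 5, 6, 8, 8 at 1 to 6.
  small-< : ∀ k → 1 ≤ k → k ≤ 6 → k < N₁ k
  small-< = up-to-6 ≤-refl (m≤m+n 3 1) (m≤m+n 4 1) (m≤m+n 5 1) (m≤m+n 6 2) (m≤m+n 7 1)

  small-bound : ∀ k → 1 ≤ k → k ≤ 6 → Bound k (N₁ k)
  small-bound = up-to-6 {λ k → Bound k (N₁ k)} bound₁ bound₂ bound₃ bound₄ bound₅ bound₆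

-- From clause-sets to matrices.

⊖≡+⇒≡+ : ∀ m n {k} → m ℤ.⊖ n ≡ ℤ.+ k → m ≡ n + k
⊖≡+⇒≡+ m n {k} eq with n ≤? m
... | yes n≤m = trans (sym (m+[n∸m]≡n n≤m))
  (cong (n +_) (ℤ.+-injective (trans (sym (ℤ.⊖-≥ n≤m)) eq)))
... | no n≰m with n ∸ m in n∸m | trans (sym (ℤ.⊖-≰ n≰m)) eq
...   | zero  | _ = contradiction (m∸n≡0⇒m≤n n∸m) n≰m
...   | suc _ | ()

lookup-injective : ∀ {A : Set} {xs : List A} → AllPairs _≢_ xs →
                   ∀ i j → List.lookup xs i ≡ List.lookup xs j → i ≡ j
lookup-injective (x∉ ∷ uniq) zero    zero    eq = refl
lookup-injective (x∉ ∷ uniq) zero    (suc j) eq = contradiction eq (All.lookup x∉ (∈-lookup j))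
lookup-injective (x∉ ∷ uniq) (suc i) zero eq = contradiction (sym eq) (All.lookup x∉ (∈-lookup i))
lookup-injective (x∉ ∷ uniq) (suc i) (suc j) eq = cong suc (lookup-injective uniq i j eq)

∈-removeAt : ∀ {A : Set} (xs : List A) {i k} → k ≢ i → List.lookup xs k List.∈ List.removeAt xs i
∈-removeAt (x ∷ xs) {zero}  {zero}  k≢i = contradiction refl k≢i
∈-removeAt (x ∷ xs) {zero}  {suc k} k≢i = ∈-lookup k
∈-removeAt (x ∷ xs@(_ ∷ _)) {suc i} {zero}  k≢i = here refl
∈-removeAt (x ∷ xs@(_ ∷ _)) {suc i} {suc k} k≢i = there (∈-removeAt xs (k≢i ∘ cong suc))

opaque
  unfolding Sub

  length-filter≤cnt : ∀ {A : Set} {P : A → Set} (P? : ∀ x → Dec (P x)) xs {p : Sub (List.length xs)} →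
                      (∀ i → P (List.lookup xs i) → i ∈ p) → List.length (List.filter P? xs) ≤ cnt p
  length-filter≤cnt P? []       h = z≤n
  length-filter≤cnt P? (x ∷ xs) {p} h with P? x
  ... | no _   = ≤-trans (length-filter≤cnt P? xs {p ∘ suc} (h ∘ suc)) (m≤n+m _ _)
  ... | yes px rewrite h zero px = s≤s (length-filter≤cnt P? xs {p ∘ suc} (h ∘ suc))

module _ {V : Set} (_≟ᵛ_ : DecidableEquality V) where
  open ClauseSets _≟ᵛ_
  open DecMembership _≟ˡ_ using () renaming (_∈?_ to _∈ˡ?_)
  open DecMembership _≟ᵛ_ using () renaming (_∈?_ to _∈ᵛ?_)

  module Encoding (F : ClauseSet) where
    vars = var F
    #c = List.length (clauses F)
    #v = List.length vars

    lits : Fin #c → List Literal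
    lits i = literals (List.lookup (clauses F) i)

    name : Fin #v → V
    name = List.lookup vars

    matrix : Matrix #c #v
    matrix i j with (name j , true) ∈ˡ? lits i | (name j , false) ∈ˡ? lits i
    ... | yes _ | _     = just true
    ... | no _  | yes _ = just false
    ... | no _  | no _  = nothing

    matrix⁻ : ∀ i j {b} → matrix i j ≡ just b → (name j , b) List.∈ lits i
    matrix⁻ i j eq with (name j , true) ∈ˡ? lits i | (name j , false) ∈ˡ? lits i
    matrix⁻ i j refl | yes ∈t | _      = ∈t
    matrix⁻ i j refl | no _   | yes ∈f = ∈f

    matrix⁺ : ∀ i j {b} → (name j , b) List.∈ lits i → matrix i j ≡ just b
    matrix⁺ i j {b} ∈b with (name j , true) ∈ˡ? lits i | (name j , false) ∈ˡ? lits i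
    matrix⁺ i j {true}  ∈b | yes _  | _     = refl
    matrix⁺ i j {false} ∈b | yes ∈t | _     =
      contradiction (∈b , ∈-map⁺ complement ∈t) (clashFree (List.lookup (clauses F) i))
    matrix⁺ i j {true}  ∈b | no ∉t  | _     = contradiction ∈b ∉t
    matrix⁺ i j {false} ∈b | no _   | yes _ = refl
    matrix⁺ i j {false} ∈b | no _   | no ∉f = contradiction ∈b ∉f

    occurring : ∀ i {v b} → (v , b) List.∈ lits i → v List.∈ vars
    occurring i ∈lits = ∈-deduplicate⁺ _≟ᵛ_ (∈-concatMap⁺ (map proj₁ ∘ literals) {xs = clauses F}
      (lose (∈-lookup i) (∈-map⁺ proj₁ ∈lits)))

    names : List V
    names = List.concatMap (map proj₁ ∘ literals) (clauses F)

    assignment : Subset #v → Assignment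
    assignment φ v with v ∈ᵛ? vars
    ... | yes v∈ = lookup φ (index v∈)
    -- Variables outside `vars` occur in no clause, so any value will do.
    ... | no _   = true

    assignment-name : ∀ φ j → assignment φ (name j) ≡ lookup φ j
    assignment-name φ j with name j ∈ᵛ? vars
    ... | yes v∈ = cong (lookup φ) (lookup-injective (deduplicate-! _≟ᵛ_ names) (index v∈) j
      (sym (lookup-index v∈)))
    ... | no v∉  = contradiction (∈-lookup j) v∉

    matrix-MU : MinimallyUnsatisfiable F → MU matrix full full
    matrix-MU (unsatisfiable , _) .unsat φ
      -- With finitely many clauses, either a falsified one is found or all are satisfied, which
      -- contradicts unsatisfiability.
      with Fin.any? (λ i → (i ∈? full) ×-dec ¬? (satisfies? matrix full i φ))
    ... | yes found = found
    ... | no none = contradiction (assignment φ , All.tabulate true-clause) unsatisfiable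
      where
      satisfied : ∀ i → Satisfies matrix full i φ
      satisfied i with satisfies? matrix full i φ
      ... | yes sat = sat
      ... | no ¬sat = contradiction (i , ∈full i , ¬sat) none
      true-clause : ∀ {C} → C List.∈ clauses F → Any (assignment φ makesTrue_) (literals C)
      true-clause C∈ with satisfied (index C∈)
      ... | via j _ holds = subst (Any (assignment φ makesTrue_) ∘ literals) (sym (lookup-index C∈))
        (lose (matrix⁻ _ j holds) (assignment-name φ j))
    matrix-MU (_ , critically) .critical {i} _ with critically i
    ... | ψ , all = tabulate (ψ ∘ name) , λ k _ k≢i → satisfied k (All.lookup all (∈-removeAt (clauses F) k≢i))
      where
      satisfied : ∀ k → Any (ψ makesTrue_) (lits k) → Satisfies matrix full k (tabulate (ψ ∘ name))
      satisfied k sat with find sat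
      ... | (v , b) , ∈lits , ψv≡b = via j (∈full j) (matrix⁺ k j
        (subst (λ x → x List.∈ lits k) (cong₂ _,_ v≡ (begin
          b                                     ≡⟨ ψv≡b ⟨
          ψ v                                   ≡⟨ cong ψ v≡ ⟩
          ψ (name j)                            ≡⟨ lookup∘tabulate (ψ ∘ name) j ⟨
          lookup (tabulate (ψ ∘ name)) j        ∎)) ∈lits))
        where
        open ≡-Reasoning
        j = index (occurring k ∈lits)
        v≡ : v ≡ name j
        v≡ = lookup-index (occurring k ∈lits)

    vdeg≤deg : ∀ j → vdeg F (name j) ≤ deg matrix full j
    vdeg≤deg j = length-filter≤cnt _ (clauses F) λ i occurs →
      ∈∩⁺ (∈full i) ([ ∈Occ⁺ ∘ matrix⁺ i j , ∈Occ⁺ ∘ matrix⁺ i j ]′ occurs)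

    matrix-MinUnsat : ∀ {k} → MUδ= k F → (ne : var F ≢ []) →
                      MinUnsat k (minvdeg F ne) matrix full full
    matrix-MinUnsat (isMU , δ≡k) ne = record
      { mu      = matrix-MU isMU
      ; size    = trans (cnt-full #c) (trans (⊖≡+⇒≡+ #c #v δ≡k) (cong (_+ _) (sym (cnt-full #v))))
      ; degrees = λ {j} _ → ≤-trans (minimum≤ (vdeg F) vars ne (∈-lookup j)) (vdeg≤deg j)
      }
      where
      minimum≤ : ∀ f vs (ne : vs ≢ []) {v} → v List.∈ vs → minimumOf f vs ne ≤ f v
      minimum≤ f []       ne ()
      minimum≤ f (v ∷ vs) ne (here refl) = min≤⊤ (f v) (map f vs)
      minimum≤ f (v ∷ vs) ne (there v∈)  = All.lookup (min≤xs (f v) (map f vs)) (∈-map⁺ f v∈)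

    some-var : var F ≢ [] → ∃ λ (j : Fin #v) → j ∈ full
    some-var ne with vars
    ... | []    = contradiction refl ne
    ... | _ ∷ _ = zero , ∈full zero

theorem14p6 : {V : Set} (_≟_ : DecidableEquality V) → let open ClauseSets _≟_ in
    (k : ℕ) → 1 ≤ k → sup (minvdegs (MUδ= k)) ⊑ [ N₁ k ]
theorem14p6 _≟_ k 1≤k n (F , isMU , ne , refl) =
  [ bound-N₁ k 1≤k (Encoding.matrix-MinUnsat _≟_ F isMU ne) (Encoding.some-var _≟_ F ne) ]
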